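{- If $G$ is a finite, simple, connected graph of order $n(G)\geq 3$, then $\gamma_{r2}(G)+\gamma_R(G)\leq \frac{6}{4}n(G)$, with equality if and only if $G\in\mathcal{G}$.
   Context: For a positive integer $k$, $\mathcal{T}_k$ is the set of all trees $T$ obtained from $k$ vertex-disjoint paths $a_1b_1c_1d_1,\ldots,a_kb_kc_kd_k$ of order $4$ by adding edges between vertices of $\{b_1,\ldots,b_k\}$ so that the induced subgraph $T[\{b_1,\ldots,b_k\}]$ is a tree. The class $\mathcal{G}$ consists of the connected graphs $G$ that arise either from the unique tree in $\mathcal{T}_2$ (i.e. the paths $a_1b_1c_1d_1$, $a_2b_2c_2d_2$ plus the edge $b_1b_2$) by adding the edge $c_1c_2$, or from some tree in $\mathcal{T}_k$ (for some $k\geq 1$) by adding arbitrary edges between vertices of $\{b_1,\ldots,b_k\}$. A $2$-rainbow dominating function of a graph $G$ is a function $f:V(G)\to 2^{\{1,2\}}$ such that $\bigcup_{v\in N_G(u)}f(v)=\{1,2\}$ for every vertex $u$ with $f(u)=\emptyset$; its weight is $\sum_{u}|f(u)|$, and $\gamma_{r2}(G)$ is the minimum weight of such a function. A Roman dominating function of $G$ is a function $g:V(G)\to\{0,1,2\}$ such that every vertex $u$ with $g(u)=0$ has a neighbor $v$ with $g(v)=2$; its weight is $\sum_u g(u)$, and $\gamma_R(G)$ is the minimum weight of such a function. -}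

module Defs where

open import Data.Nat using (ℕ; zero; suc; _+_; _*_; _∸_; _≤_; _⊓_)
open import Data.Bool using (Bool; true; false; _∧_; _∨_; not; if_then_else_)
open import Data.Fin using (Fin; toℕ) renaming (zero to fzero; suc to fsuc)
open import Data.List using (List; []; _∷_; [_]; map; concatMap; foldr; filter; allFin)
open import Data.Nat.ListAction using (sum)
open import Data.Bool.ListAction using (any; all)
open import Data.Product using (_×_; _,_; proj₁; proj₂; Σ; ∃)
open import Data.Sum using (_⊎_)
open import Relation.Binary.PropositionalEquality using (_≡_)
open import Relation.Nullary using (¬_)
open import Function.Bundles using (_⤖_; _⇔_; Bijection)

record Graph (n : ℕ) : Set where
  field
    adj    : Fin n → Fin n → Bool
    sym    : ∀ u v → adj u v ≡ adj v u
    irrefl : ∀ u → adj u u ≡ false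
open Graph public

order : ∀ {n} → Graph n → ℕ
order {n} _ = n

data Reach {n : ℕ} (G : Graph n) : Fin n → Fin n → Set where
  here : ∀ {u} → Reach G u u
  step : ∀ {u v w} → adj G u v ≡ true → Reach G v w → Reach G u w

Connected : ∀ {n} → Graph n → Set
Connected {n} G = ∀ (u v : Fin n) → Reach G u v

Σv : ∀ {n} → (Fin n → ℕ) → ℕ
Σv {n} w = sum (map w (allFin n))

allFuns : ∀ {A : Set} (n : ℕ) → List A → List (Fin n → A)
allFuns zero xs = [ (λ ()) ]
allFuns (suc n) xs =
  concatMap (λ a → map (λ f → λ { fzero → a ; (fsuc i) → f i }) (allFuns n xs)) xs

bool→ℕ : Bool → ℕ
bool→ℕ true = 1
bool→ℕ false = 0

-- 2-rainbow domination.
-- A subset of {1,2} is encoded as a pair of Booleans (1 ∈ S , 2 ∈ S).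

Sub12 : Set
Sub12 = Bool × Bool

allSub12 : List Sub12
allSub12 = (false , false) ∷ (true , false) ∷ (false , true) ∷ (true , true) ∷ []

card12 : Sub12 → ℕ
card12 (x , y) = bool→ℕ x + bool→ℕ y

isEmpty12 : Sub12 → Bool
isEmpty12 (x , y) = not (x ∨ y)

isR2DF : ∀ {n} → Graph n → (Fin n → Sub12) → Bool
isR2DF {n} G f =
  all (λ u → if isEmpty12 (f u)
             then (any (λ v → adj G u v ∧ proj₁ (f v)) (allFin n)
                   ∧ any (λ v → adj G u v ∧ proj₂ (f v)) (allFin n))
             else true)
      (allFin n)

weightR2 : ∀ {n} → (Fin n → Sub12) → ℕ
weightR2 f = Σv (λ u → card12 (f u))

-- γ_{r2}(G): minimum weight of a 2RDF (the constant function {1} is a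
-- 2RDF of weight n, so n is a valid starting bound for the minimum).
γr2 : ∀ {n} → Graph n → ℕ
γr2 {n} G = foldr _⊓_ n (map weightR2 (filter (λ f → isR2DF G f ≡? true) (allFuns n allSub12)))
  where
    open import Data.Bool.Properties using () renaming (_≟_ to _≡?_)

isRDF : ∀ {n} → Graph n → (Fin n → Fin 3) → Bool
isRDF {n} G g =
  all (λ u → if isZero (g u)
             then any (λ v → adj G u v ∧ isTwo (g v)) (allFin n)
             else true)
      (allFin n)
  where
    isZero : Fin 3 → Bool
    isZero fzero = true
    isZero _ = false
    isTwo : Fin 3 → Bool
    isTwo (fsuc (fsuc fzero)) = true
    isTwo _ = false

weightR : ∀ {n} → (Fin n → Fin 3) → ℕ
weightR g = Σv (λ u → toℕ (g u))

allFin3 : List (Fin 3)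
allFin3 = allFin 3

-- γ_R(G): minimum weight of a Roman dominating function (the constant
-- function 1 is an RDF of weight n).
γR : ∀ {n} → Graph n → ℕ
γR {n} G = foldr _⊓_ n (map weightR (filter (λ g → isRDF G g ≡? true) (allFuns n allFin3)))
  where
    open import Data.Bool.Properties using () renaming (_≟_ to _≡?_)

-- The class 𝒢.
-- Vertices of the k paths a_i b_i c_i d_i are indexed by Fin k × Fin 4
-- with a = 0, b = 1, c = 2, d = 3.

PathEdge : ∀ {k} → Fin k × Fin 4 → Fin k × Fin 4 → Set
PathEdge (i , p) (j , q) = i ≡ j × (suc (toℕ p) ≡ toℕ q ⊎ suc (toℕ q) ≡ toℕ p)

-- number of edges (counted via the degree sum: 2|E| = Σ deg)
degSum : ∀ {k} → Graph k → ℕ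
degSum {k} B = Σv (λ u → Σv (λ v → bool→ℕ (adj B u v)))

IsTree : ∀ {k} → Graph k → Set
IsTree {k} B = Connected B × degSum B ≡ 2 * (k ∸ 1)

_⊆G_ : ∀ {k} → Graph k → Graph k → Set
B ⊆G C = ∀ i j → adj B i j ≡ true → adj C i j ≡ true

-- G arises (up to isomorphism) from the unique tree of 𝒯₂ by adding c₁c₂
FromT2PlusC : ∀ {n} → Graph n → Set
FromT2PlusC {n} G =
  Σ ((Fin 2 × Fin 4) ⤖ Fin n) λ φ →
    ∀ x y → (adj G (Bijection.to φ x) (Bijection.to φ y) ≡ true) ⇔
            (PathEdge x y
             ⊎ (¬ proj₁ x ≡ proj₁ y × toℕ (proj₂ x) ≡ 1 × toℕ (proj₂ y) ≡ 1)
             ⊎ (¬ proj₁ x ≡ proj₁ y × toℕ (proj₂ x) ≡ 2 × toℕ (proj₂ y) ≡ 2))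

-- G arises (up to isomorphism) from a tree of 𝒯_k (k ≥ 1) by adding
-- arbitrary edges among b_1,…,b_k: the graph C induced on the b's
-- contains a spanning tree B (the tree T[{b_1,…,b_k}]).
FromTkPlusB : ∀ {n} → Graph n → Set
FromTkPlusB {n} G =
  Σ ℕ λ k → 1 ≤ k × Σ (Graph k) λ B → Σ (Graph k) λ C →
    IsTree B × B ⊆G C ×
    Σ ((Fin k × Fin 4) ⤖ Fin n) λ φ →
      ∀ x y → (adj G (Bijection.to φ x) (Bijection.to φ y) ≡ true) ⇔
              (PathEdge x y
               ⊎ (toℕ (proj₂ x) ≡ 1 × toℕ (proj₂ y) ≡ 1 × adj C (proj₁ x) (proj₁ y) ≡ true))

InClassG : ∀ {n} → Graph n → Set
InClassG G = FromT2PlusC G ⊎ FromTkPlusB G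

{-# OPTIONS --safe #-}
module Submission where

-- Upper bound: adding the vertices one at a time along edges, the graph decomposes into spiders of
-- order at least 3 (a centre with legs of length 1 or 2). On a spider with l short and t long legs,
-- giving the centre {1,2} (resp. 2) and the far ends weight 1 costs 4 + 2t in total, which is less
-- than 6/4 (1 + l + 2t), except that P₃ must be centred properly, P₅ needs alternating colours, and
-- P₄ gives equality.
--
-- Equality: the graph is tiled by paths aᵢbᵢcᵢdᵢ. A cheaper pair of functions on one, two or three
-- of the tiles excludes all chords, all edges at aᵢ or dᵢ between tiles, two edges from bᵢ to the
-- same tile, and edges from bᵢ and cᵢ to different tiles. Hence either two tiles joined by the
-- edges b₁b₂ and c₁c₂ are the whole graph, or after reversing tiles all further edges join bᵢ's.
--
-- Conversely, a vertex x with a pendant neighbour x′ either carries weight at least 2 together with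
-- x′, or it has value 0 and a further neighbour of positive weight; on the graphs in 𝒢 this forces
-- weight 3 per tile.

open import Defs
import Algebra.Solver.CommutativeMonoid as CMSolver
open import Data.Bool using (Bool; true; false; _∧_; _∨_; not; if_then_else_)
open import Data.Bool.ListAction using (any; all)
open import Data.Bool.Properties as Bool using (∨-zeroʳ; ∨-comm)
open import Data.Empty using (⊥)
open import Data.Fin using (Fin; zero; suc; toℕ; opposite; combine; remQuot; punchOut)
open import Data.Fin.Properties
  using (_≟_; all?; any?; ¬∀⟶∃¬; toℕ-injective; opposite-involutive; injective⇒≤; punchOut-injective;
         combine-injective; remQuot-combine)
open import Data.List
  using (List; []; _∷_; _++_; [_]; map; filter; foldr; concatMap; tabulate; allFin; length; lookup;
         cartesianProduct)
open import Data.List.Membership.DecPropositional using (_∈?_)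
open import Data.List.Membership.Propositional using (_∈_; _∉_; lose; find)
open import Data.List.Membership.Propositional.Properties
  using (∈-map⁺; ∈-map⁻; ∈-++⁺ˡ; ∈-++⁺ʳ; ∈-++⁻; ∈-∃++; ∈-allFin; ∈-tabulate⁻; ∈-concatMap⁺;
         ∈-concatMap⁻; ∈-cartesianProduct⁺; ∈-lookup)
open import Data.List.Membership.Propositional.Properties.WithK using (unique∧set⇒bag)
open import Data.List.Properties
  using (length-++; length-tabulate; length-map; map-++; map-id; map-∘; map-cong; map-tabulate;
         concatMap-++; ++-identityʳ)
open import Data.List.Relation.Binary.BagAndSetEquality using (∼bag⇒↭)
open import Data.List.Relation.Binary.Permutation.Propositional
  using (_↭_; prep; swap; ↭-refl; ↭-sym; ↭-trans; ↭-reflexive)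
open import Data.List.Relation.Binary.Permutation.Propositional.Properties
  using (All-resp-↭; ∈-resp-↭; ↭-length; shift; ++⁺ˡ; ++⁺ʳ; ++-commutativeMonoid)
  renaming (map⁺ to ↭-map⁺)
open import Data.List.Relation.Unary.All as All using (All; []; _∷_)
import Data.List.Relation.Unary.All.Properties as All
open import Data.List.Relation.Unary.AllPairs using ([]; _∷_)
open import Data.List.Relation.Unary.Any as Any using (Any; here; there)
import Data.List.Relation.Unary.Any.Properties as Any
open import Data.List.Relation.Unary.Unique.Propositional using (Unique)
open import Data.List.Relation.Unary.Unique.Propositional.Properties
  using (allFin⁺; tabulate⁺; cartesianProduct⁺) renaming (map⁺ to unique-map⁺)
open import Data.Nat as ℕ
  using (ℕ; zero; suc; _+_; _*_; _∸_; _≤_; _<_; _⊓_; z≤n; s≤s; _≤?_)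
open import Data.Nat.ListAction using (sum)
open import Data.Nat.ListAction.Properties using (sum-++; sum-↭)
open import Data.Nat.Properties hiding (_≟_; _≤?_)
open import Data.Nat.Tactic.RingSolver using (solve-∀)
open import Data.Product using (_×_; _,_; proj₁; proj₂; ∃; ∃-syntax; map₁; uncurry)
open import Data.Product.Properties using (≡-dec)
open import Data.Sum using (_⊎_; inj₁; inj₂)
open import Function using (_∘_; id)
open import Function.Bundles using (_⤖_; mk⤖; _⇔_; mk⇔; Bijection; Equivalence)
open import Level using (0ℓ)
open import Relation.Binary using (Rel; DecidableEquality) renaming (Decidable to Decidable₂)
open import Relation.Binary.PropositionalEquality
  using (_≡_; _≢_; _≗_; refl; cong; cong₂; subst; subst₂; module ≡-Reasoning)
  renaming (sym to ≡-sym; trans to ≡-trans)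
open import Relation.Nullary using (¬_; Dec; yes; no; does; contradiction)
open import Relation.Nullary.Decidable
  using (True; toWitness; from-yes; decidable-stable; dec-true; dec-false; ¬?; _×-dec_; _⊎-dec_; _→-dec_)
open import Relation.Unary using (Pred; Decidable)

-- Both parameters are bounded together: a configuration proposes a pair of functions, and its
-- validity uses only edges that are present. This is why configurations of several pieces can be
-- concatenated, why a vertex may receive several proposals (merging them never raises the weight),
-- and why a pair of functions on a few tiles can be judged without knowing the other edges of the
-- graph. The upper bound is kept as a certificate: either the cost is strictly below 6/4 per
-- vertex, or it is exactly that and every spider has one leaf and one leg. So the tiling that the
-- equality case needs is a by-product of the bound. From then on each tile can be charged 6, any
-- pair of functions on m tiles of weight below 6m contradicts equality, and each exclusion of an
-- edge becomes a finite check. For the converse, the 6 per tile split into 3 for each parameter.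
-- The obstacle is the graph with the edge c₁c₂, where a single tile may carry only weight 2; there
-- the two tiles have to be counted together.

private
  variable
    n k m : ℕ
    A V W : Set

pattern 0F = zero
pattern 1F = suc zero
pattern 2F = suc (suc zero)
pattern 3F = suc (suc (suc zero))

-- Adjacency, Boolean quantifiers and finite sums

_∼[_]_ : Fin n → Graph n → Fin n → Set
u ∼[ G ] v = adj G u v ≡ true

∼-sym : (G : Graph n) → ∀ {u v} → u ∼[ G ] v → v ∼[ G ] u
∼-sym G {u} {v} e = ≡-trans (Graph.sym G v u) e

∼-irrefl : (G : Graph n) → ∀ {u} → u ∼[ G ] u → ⊥
∼-irrefl G {u} e with ≡-trans (≡-sym e) (irrefl G u)
... | ()

∧-true⁻ : ∀ a {b} → a ∧ b ≡ true → a ≡ true × b ≡ true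
∧-true⁻ true eq = refl , eq

all-true⁻ : (p : A → Bool) (xs : List A) → all p xs ≡ true → ∀ {x} → x ∈ xs → p x ≡ true
all-true⁻ p (x ∷ xs) eq (here refl) = proj₁ (∧-true⁻ (p x) eq)
all-true⁻ p (x ∷ xs) eq (there x∈)  = all-true⁻ p xs (proj₂ (∧-true⁻ (p x) eq)) x∈

all-true⁺ : (p : A → Bool) (xs : List A) → (∀ x → p x ≡ true) → all p xs ≡ true
all-true⁺ p []       h = refl
all-true⁺ p (x ∷ xs) h rewrite h x = all-true⁺ p xs h

any-true⁻ : (p : A → Bool) (xs : List A) → any p xs ≡ true → ∃[ x ] p x ≡ true
any-true⁻ p (x ∷ xs) eq with p x in px
... | true  = x , px
... | false = any-true⁻ p xs eq

any-true⁺ : (p : A → Bool) {xs : List A} → ∀ {x} → x ∈ xs → p x ≡ true → any p xs ≡ true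
any-true⁺ p (here refl) px rewrite px = refl
any-true⁺ p {y ∷ _} (there x∈) px rewrite any-true⁺ p x∈ px = ∨-zeroʳ (p y)

all-false⁻ : (p : A → Bool) (xs : List A) → all p xs ≡ false → ∃[ x ] p x ≡ false
all-false⁻ p (x ∷ xs) eq with p x in px
... | false = x , px
... | true  = all-false⁻ p xs eq

any-false⁻ : (p : A → Bool) {xs : List A} → any p xs ≡ false → ∀ {x} → x ∈ xs → p x ≡ false
any-false⁻ p {x ∷ _} eq x∈ with p x in px
any-false⁻ p eq (here refl) | false = px
any-false⁻ p eq (there x∈)  | false = any-false⁻ p eq x∈

Σv-suc : (w : Fin (suc n) → ℕ) → Σv w ≡ w zero + Σv (w ∘ suc)
Σv-suc w = cong (λ xs → w zero + sum xs)
  (≡-trans (map-tabulate suc w) (≡-sym (map-tabulate id (w ∘ suc))))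

Σv-cong : {w w′ : Fin n → ℕ} → w ≗ w′ → Σv w ≡ Σv w′
Σv-cong {n} eq = cong sum (map-cong eq (allFin n))

sum-map-+ : (f g : A → ℕ) (xs : List A) →
            sum (map (λ x → f x + g x) xs) ≡ sum (map f xs) + sum (map g xs)
sum-map-+ f g []       = refl
sum-map-+ f g (x ∷ xs) rewrite sum-map-+ f g xs = lemma (f x) (g x) _ _
  where
  lemma : ∀ a b c d → a + b + (c + d) ≡ a + c + (b + d)
  lemma = solve-∀

sum-map-≤ : {f g : A → ℕ} → (∀ x → f x ≤ g x) → (xs : List A) → sum (map f xs) ≤ sum (map g xs)
sum-map-≤ f≤g []       = z≤n
sum-map-≤ f≤g (x ∷ xs) = +-mono-≤ (f≤g x) (sum-map-≤ f≤g xs)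

Σv-zero : Σv {n} (λ _ → 0) ≡ 0
Σv-zero {zero}  = refl
Σv-zero {suc n} = ≡-trans (Σv-suc {n} (λ _ → 0)) (Σv-zero {n})

Σv-δ : (x : Fin n) (a : ℕ) → Σv (λ v → if does (x ≟ v) then a else 0) ≡ a
Σv-δ {suc n} zero a = begin
  Σv {suc n} (λ v → if does (zero ≟ v) then a else 0)
    ≡⟨ Σv-suc {n} (λ v → if does (zero ≟ v) then a else 0) ⟩
  a + Σv {n} (λ _ → 0)                        ≡⟨ cong (a +_) (Σv-zero {n}) ⟩
  a + 0                                       ≡⟨ +-identityʳ a ⟩
  a                                           ∎
  where open ≡-Reasoning
Σv-δ {suc n} (suc x) a = begin
  Σv {suc n} (λ v → if does (suc x ≟ v) then a else 0)
    ≡⟨ Σv-suc {n} (λ v → if does (suc x ≟ v) then a else 0) ⟩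
  Σv {n} (λ v → if does (x ≟ v) then a else 0)         ≡⟨ Σv-δ x a ⟩
  a                                            ∎
  where open ≡-Reasoning

-- Dominating functions and the minima `γr2` and `γR`

module _ {P : Pred A 0ℓ} (P? : Decidable P) (w : A → ℕ) (b : ℕ) where

  min-≤ : ∀ {xs x} → x ∈ xs → P x → foldr _⊓_ b (map w (filter P? xs)) ≤ w x
  min-≤ {x ∷ xs} (here refl) px with P? x
  ... | yes _ = m⊓n≤m (w x) _
  ... | no ¬p = contradiction px ¬p
  min-≤ {y ∷ xs} (there x∈) px with P? y
  ... | yes _ = ≤-trans (m⊓n≤n (w y) _) (min-≤ x∈ px)
  ... | no _  = min-≤ x∈ px

  min-≥ : ∀ {m} → m ≤ b → (∀ x → P x → m ≤ w x) → ∀ xs → m ≤ foldr _⊓_ b (map w (filter P? xs))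
  min-≥ m≤b h []       = m≤b
  min-≥ m≤b h (x ∷ xs) with P? x
  ... | yes p = ⊓-glb (h x p) (min-≥ m≤b h xs)
  ... | no _  = min-≥ m≤b h xs

-- Without function extensionality `f` itself need not occur in the list, only a function that
-- agrees with it pointwise. Hence domination is transported along `h ≗ f` below.
∈-allFuns : {xs : List A} → (∀ a → a ∈ xs) → ∀ n (f : Fin n → A) → ∃[ h ] h ∈ allFuns n xs × h ≗ f
∈-allFuns full zero    f = _ , here refl , λ ()
∈-allFuns full (suc n) f with ∈-allFuns full n (f ∘ suc)
... | h , h∈ , h≗ =
  _ , ∈-concatMap⁺ _ (lose (full (f zero)) (∈-map⁺ _ h∈)) , λ { zero → refl ; (suc i) → h≗ i }

∅ full : Sub12
∅    = false , false
full = true , true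

Rainbow : Graph n → (Fin n → Sub12) → Set
Rainbow G f = ∀ u → f u ≡ ∅ → (∃[ v ] u ∼[ G ] v × proj₁ (f v) ≡ true)
                            × (∃[ v ] u ∼[ G ] v × proj₂ (f v) ≡ true)

Roman : Graph n → (Fin n → Fin 3) → Set
Roman G g = ∀ u → g u ≡ 0F → ∃[ v ] u ∼[ G ] v × g v ≡ 2F

isR2DF⁻ : (G : Graph n) (f : Fin n → Sub12) → isR2DF G f ≡ true → Rainbow G f
isR2DF⁻ G f eq u fu≡∅ with f u | all-true⁻ _ (allFin _) eq (∈-allFin u)
isR2DF⁻ {n} G f eq u refl | _ | eq′ with ∧-true⁻ (any _ (allFin n)) eq′
... | l , r with any-true⁻ _ (allFin n) l | any-true⁻ _ (allFin n) r
... | v , hv | w , hw = (v , ∧-true⁻ (adj G u v) hv) , (w , ∧-true⁻ (adj G u w) hw)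

isR2DF⁺ : (G : Graph n) (f : Fin n → Sub12) → Rainbow G f → isR2DF G f ≡ true
isR2DF⁺ {n} G f R = all-true⁺ _ (allFin n) at
  where
  at : ∀ u → (if isEmpty12 (f u)
              then (any (λ v → adj G u v ∧ proj₁ (f v)) (allFin n)
                    ∧ any (λ v → adj G u v ∧ proj₂ (f v)) (allFin n))
              else true) ≡ true
  at u with f u | R u
  ... | true  , _     | _ = refl
  ... | false , true  | _ = refl
  ... | false , false | h with h refl
  ... | (v , uv , fv) , (w , uw , fw) =
    cong₂ _∧_ (any-true⁺ (λ v → adj G u v ∧ proj₁ (f v)) (∈-allFin v) (cong₂ _∧_ uv fv))
              (any-true⁺ (λ v → adj G u v ∧ proj₂ (f v)) (∈-allFin w) (cong₂ _∧_ uw fw))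

isRDF⁻ : (G : Graph n) (g : Fin n → Fin 3) → isRDF G g ≡ true → Roman G g
isRDF⁻ G g eq u gu≡0 with g u | all-true⁻ _ (allFin _) eq (∈-allFin u)
isRDF⁻ G g eq u refl | _ | eq′ with any-true⁻ _ (allFin _) eq′
... | v , hv with ∧-true⁻ (adj G u v) hv
... | uv , gv with g v in gv≡
... | 2F = v , uv , gv≡

-- The tests on values in isRDF are local to its definition, so they are never named: the proof
-- refutes isRDF G g ≡ false instead.
isRDF⁺ : (G : Graph n) (g : Fin n → Fin 3) → Roman G g → isRDF G g ≡ true
isRDF⁺ G g R with isRDF G g in eq
... | true  = refl
... | false with all-false⁻ _ (allFin _) eq
... | u , hu with g u | hu | R u
... | zero | hu′ | h with h refl
... | v , uv , gv with any-false⁻ _ hu′ (∈-allFin v)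
... | hv rewrite uv | gv with hv
... | ()

allSub12-full : ∀ s → s ∈ allSub12
allSub12-full (false , false) = here refl
allSub12-full (true  , false) = there (here refl)
allSub12-full (false , true)  = there (there (here refl))
allSub12-full (true  , true)  = there (there (there (here refl)))

γr2-≤ : (G : Graph n) (f : Fin n → Sub12) → Rainbow G f → γr2 G ≤ weightR2 f
γr2-≤ {n} G f R with ∈-allFuns allSub12-full n f
... | h , h∈ , h≗ = ≤-trans (min-≤ _ weightR2 n h∈ (isR2DF⁺ G h R′))
                            (≤-reflexive (Σv-cong (cong card12 ∘ h≗)))
  where
  R′ : Rainbow G h
  R′ u hu with R u (≡-trans (≡-sym (h≗ u)) hu)
  ... | (v , uv , fv) , (w , uw , fw) =
    (v , uv , ≡-trans (cong proj₁ (h≗ v)) fv) , (w , uw , ≡-trans (cong proj₂ (h≗ w)) fw)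

γR-≤ : (G : Graph n) (g : Fin n → Fin 3) → Roman G g → γR G ≤ weightR g
γR-≤ {n} G g R with ∈-allFuns ∈-allFin n g
... | h , h∈ , h≗ = ≤-trans (min-≤ _ weightR n h∈ (isRDF⁺ G h R′))
                            (≤-reflexive (Σv-cong (cong toℕ ∘ h≗)))
  where
  R′ : Roman G h
  R′ u hu with R u (≡-trans (≡-sym (h≗ u)) hu)
  ... | v , uv , gv = v , uv , ≡-trans (h≗ v) gv

-- The hypothesis `m ≤ n` takes care of `n` as the starting value of the minimum; the same holds for
-- `γR-≥`.
γr2-≥ : ∀ {m} (G : Graph n) → m ≤ n → (∀ f → Rainbow G f → m ≤ weightR2 f) → m ≤ γr2 G
γr2-≥ {n} G m≤n h =
  min-≥ _ weightR2 n m≤n (λ f eq → h f (isR2DF⁻ G f eq)) (allFuns n allSub12)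

γR-≥ : ∀ {m} (G : Graph n) → m ≤ n → (∀ g → Roman G g → m ≤ weightR g) → m ≤ γR G
γR-≥ {n} G m≤n h =
  min-≥ _ weightR n m≤n (λ g eq → h g (isRDF⁻ G g eq)) (allFuns n allFin3)

-- Configurations

module Accumulate {C : Set} (_∙_ : C → C → C) (ε : C) (size : C → ℕ)
                  (size-∙ : ∀ x y → size (x ∙ y) ≤ size x + size y) (size-ε : size ε ≡ 0) where

  accumulate : List (Fin n × C) → Fin n → C
  accumulate []             v = ε
  accumulate ((x , c) ∷ cs) v = if does (x ≟ v) then c ∙ accumulate cs v else accumulate cs v

  -- A property that merging preserves from either side passes from one proposal to the merged
  -- value. It is applied to having colour 1, having colour 2 and being 2, and also to being
  -- nonempty or nonzero: an empty merged value shows that every proposal at the vertex was empty.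
  accumulate-absorbs : (P : C → Set) → (∀ {x} y → P x → P (x ∙ y)) → (∀ x {y} → P y → P (x ∙ y)) →
                       ∀ {cs : List (Fin n × C)} {x c} → (x , c) ∈ cs → P c → P (accumulate cs x)
  accumulate-absorbs P l r {(x , c) ∷ cs} (here refl) pc with x ≟ x
  ... | yes _  = l _ pc
  ... | no x≢x = contradiction refl x≢x
  accumulate-absorbs P l r {(y , d) ∷ cs} {x} (there x∈) pc with y ≟ x
  ... | yes _ = r d (accumulate-absorbs P l r x∈ pc)
  ... | no _  = accumulate-absorbs P l r x∈ pc

  -- By subadditivity of `size`, repeated vertices can only make the merged function lighter than
  -- the list, so disjointness of pieces never has to be checked.
  Σv-accumulate : (cs : List (Fin n × C)) → Σv (size ∘ accumulate cs) ≤ sum (map (size ∘ proj₂) cs)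
  Σv-accumulate {n} [] = ≤-reflexive (≡-trans (Σv-cong {n} (λ _ → size-ε)) (Σv-zero {n}))
  Σv-accumulate {n} ((x , c) ∷ cs) = begin
    Σv (size ∘ accumulate ((x , c) ∷ cs))          ≤⟨ sum-map-≤ split (allFin n) ⟩
    Σv (λ v → δ v + size (accumulate cs v))        ≡⟨ sum-map-+ δ (size ∘ accumulate cs) (allFin n) ⟩
    Σv δ + Σv (size ∘ accumulate cs)               ≡⟨ cong (_+ Σv (size ∘ accumulate cs)) (Σv-δ x (size c)) ⟩
    size c + Σv (size ∘ accumulate cs)             ≤⟨ +-monoʳ-≤ (size c) (Σv-accumulate cs) ⟩
    size c + sum (map (size ∘ proj₂) cs)           ∎
    where
    open ≤-Reasoning
    δ : Fin n → ℕ
    δ v = if does (x ≟ v) then size c else 0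
    split : ∀ v → size (accumulate ((x , c) ∷ cs) v) ≤ δ v + size (accumulate cs v)
    split v with does (x ≟ v)
    ... | true  = size-∙ c (accumulate cs v)
    ... | false = ≤-refl

-- An entry (v , s , r) proposes the value s for a 2-rainbow and the value r for a Roman dominating
-- function at v. Vertices may repeat in a configuration.
Entry : Set → Set
Entry V = V × Sub12 × Fin 3

Config : Set → Set
Config V = List (Entry V)

vertex : Entry V → V
vertex = proj₁

colours : Entry V → Sub12
colours e = proj₁ (proj₂ e)

rank : Entry V → Fin 3
rank e = proj₂ (proj₂ e)

entryWeight : Entry V → ℕ
entryWeight e = card12 (colours e) + toℕ (rank e)

weight : Config V → ℕ
weight S = sum (map entryWeight S)

vertices : Config V → List V
vertices = map vertex

Defended : Rel V 0ℓ → Config V → Pred (Entry V) 0ℓ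
Defended _~_ S e =
  (colours e ≡ ∅ → Any (λ d → vertex e ~ vertex d × proj₁ (colours d) ≡ true) S
                 × Any (λ d → vertex e ~ vertex d × proj₂ (colours d) ≡ true) S)
  × (rank e ≡ 0F → Any (λ d → vertex e ~ vertex d × rank d ≡ 2F) S)

Valid : Rel V 0ℓ → Pred (Config V) 0ℓ
Valid _~_ S = All (Defended _~_ S) S

defended? : {_~_ : Rel V 0ℓ} → Decidable₂ _~_ → (S : Config V) → Decidable (Defended _~_ S)
defended? _~?_ S e =
  (≡-dec Bool._≟_ Bool._≟_ (colours e) ∅ →-dec
    (Any.any? (λ d → (vertex e ~? vertex d) ×-dec (proj₁ (colours d) Bool.≟ true)) S
     ×-dec Any.any? (λ d → (vertex e ~? vertex d) ×-dec (proj₂ (colours d) Bool.≟ true)) S))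
  ×-dec (rank e ≟ 0F →-dec Any.any? (λ d → (vertex e ~? vertex d) ×-dec (rank d ≟ 2F)) S)

valid? : {_~_ : Rel V 0ℓ} → Decidable₂ _~_ → Decidable (Valid _~_)
valid? _~?_ S = All.all? (defended? _~?_ S) S

defended-mono : (_~_ : Rel V 0ℓ) {S T : Config V} → (∀ {e} → e ∈ S → e ∈ T) →
                ∀ {e} → Defended _~_ S e → Defended _~_ T e
defended-mono _ {S} {T} S⊆T (f , g) =
  (λ eq → move (proj₁ (f eq)) , move (proj₂ (f eq))) , λ eq → move (g eq)
  where
  move : {P : Pred _ 0ℓ} → Any P S → Any P T
  move p with find p
  ... | _ , e∈S , pe = lose (S⊆T e∈S) pe

valid-++ : (_~_ : Rel V 0ℓ) {S T : Config V} → Valid _~_ S → Valid _~_ T → Valid _~_ (S ++ T)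
valid-++ _~_ {S} vS vT =
  All.++⁺ (All.map (defended-mono _~_ ∈-++⁺ˡ) vS) (All.map (defended-mono _~_ (∈-++⁺ʳ S)) vT)

-- A defence only asks for edges that are present, so any homomorphism transports it, even into a
-- graph with further edges.
valid-map : (_~_ : Rel V 0ℓ) (_≈_ : Rel W 0ℓ) (h : V → W) → (∀ {x y} → x ~ y → h x ≈ h y) →
            {S : Config V} → Valid _~_ S → Valid _≈_ (map (map₁ h) S)
valid-map _~_ _≈_ h hom {S} vS = All.map⁺ (All.map image vS)
  where
  move : {x : _} {P : Pred (Sub12 × Fin 3) 0ℓ} → Any (λ d → x ~ vertex d × P (proj₂ d)) S →
         Any (λ d → h x ≈ vertex d × P (proj₂ d)) (map (map₁ h) S)
  move = Any.map⁺ ∘ Any.map (map₁ hom)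
  image : ∀ {e} → Defended _~_ S e → Defended _≈_ (map (map₁ h) S) (map₁ h e)
  image (f , g) = (λ eq → move {P = λ c → proj₁ (proj₁ c) ≡ true} (proj₁ (f eq))
                        , move {P = λ c → proj₂ (proj₁ c) ≡ true} (proj₂ (f eq)))
                  , λ eq → move {P = λ c → proj₂ c ≡ 2F} (g eq)

weight-++ : (S T : Config V) → weight (S ++ T) ≡ weight S + weight T
weight-++ S T = ≡-trans (cong sum (map-++ entryWeight S T)) (sum-++ (map entryWeight S) (map entryWeight T))

weight-map : (h : V → W) (S : Config V) → weight (map (map₁ h) S) ≡ weight S
weight-map h S = cong sum (≡-sym (map-∘ S))

vertices-map : (h : V → W) (S : Config V) → vertices (map (map₁ h) S) ≡ map h (vertices S)
vertices-map h S = ≡-trans (≡-sym (map-∘ S)) (map-∘ S)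

_∪_ : Sub12 → Sub12 → Sub12
(a , b) ∪ (c , d) = a ∨ c , b ∨ d

bool→ℕ-∨ : ∀ a b → bool→ℕ (a ∨ b) ≤ bool→ℕ a + bool→ℕ b
bool→ℕ-∨ true  b = s≤s z≤n
bool→ℕ-∨ false b = ≤-refl

card12-∪ : ∀ s t → card12 (s ∪ t) ≤ card12 s + card12 t
card12-∪ (a , b) (c , d) =
  ≤-trans (+-mono-≤ (bool→ℕ-∨ a c) (bool→ℕ-∨ b d)) (≤-reflexive (lemma (bool→ℕ a) _ _ _))
  where
  lemma : ∀ a c b d → a + c + (b + d) ≡ a + b + (c + d)
  lemma = solve-∀

-- The maximum of two Roman values; unlike the sum it stays in the range 0, 1, 2.
_⊔₃_ : Fin 3 → Fin 3 → Fin 3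
0F      ⊔₃ y     = y
suc x   ⊔₃ 0F    = suc x
1F      ⊔₃ suc y = suc y
2F      ⊔₃ suc y = 2F

⊔₃-size : ∀ x y → toℕ (x ⊔₃ y) ≤ toℕ x + toℕ y
⊔₃-size 0F      y       = ≤-refl
⊔₃-size (suc x) 0F      = m≤m+n _ 0
⊔₃-size 1F      (suc y) = n≤1+n _
⊔₃-size 2F      (suc y) = s≤s (s≤s z≤n)

module Colours = Accumulate _∪_ ∅ card12 card12-∪ refl
module Ranks = Accumulate _⊔₃_ 0F toℕ ⊔₃-size refl

module _ (G : Graph n) (S : Config (Fin n)) (valid : Valid (λ u v → u ∼[ G ] v) S)
         (covers : ∀ v → v ∈ vertices S) where

  private
    coloured : List (Fin n × Sub12)
    coloured = map (λ e → vertex e , colours e) S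

    ranked : List (Fin n × Fin 3)
    ranked = map (λ e → vertex e , rank e) S

    f : Fin n → Sub12
    f = Colours.accumulate coloured

    g : Fin n → Fin 3
    g = Ranks.accumulate ranked

    f₁ : ∀ {e} → e ∈ S → proj₁ (colours e) ≡ true → proj₁ (f (vertex e)) ≡ true
    f₁ e∈ = Colours.accumulate-absorbs (λ s → proj₁ s ≡ true)
              (λ { _ refl → refl }) (λ { x refl → ∨-zeroʳ (proj₁ x) }) (∈-map⁺ _ e∈)

    f₂ : ∀ {e} → e ∈ S → proj₂ (colours e) ≡ true → proj₂ (f (vertex e)) ≡ true
    f₂ e∈ = Colours.accumulate-absorbs (λ s → proj₂ s ≡ true)
              (λ { _ refl → refl }) (λ { x refl → ∨-zeroʳ (proj₂ x) }) (∈-map⁺ _ e∈)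

    g₂ : ∀ {e} → e ∈ S → rank e ≡ 2F → g (vertex e) ≡ 2F
    g₂ e∈ = Ranks.accumulate-absorbs (_≡ 2F)
              (λ { 0F refl → refl ; (suc _) refl → refl })
              (λ { 0F refl → refl ; 1F refl → refl ; 2F refl → refl }) (∈-map⁺ _ e∈)

    f-∅ : ∀ {e} → e ∈ S → f (vertex e) ≡ ∅ → colours e ≡ ∅
    f-∅ {e} e∈ eq = decidable-stable (≡-dec Bool._≟_ Bool._≟_ _ _) λ e≢∅ →
      Colours.accumulate-absorbs (_≢ ∅)
        (λ { {true , _} _ _ () ; {false , true} _ _ () ; {false , false} _ ¬e _ → ¬e refl })
        (λ { (true , _) _ () ; (false , true) {true , _} _ () ; (false , true) {false , _} _ ()
           ; (false , false) ¬e → ¬e })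
        (∈-map⁺ _ e∈) e≢∅ eq

    g-0 : ∀ {e} → e ∈ S → g (vertex e) ≡ 0F → rank e ≡ 0F
    g-0 {e} e∈ eq = decidable-stable (_ ≟ _) λ e≢0 →
      Ranks.accumulate-absorbs (_≢ 0F)
        (λ { {0F} _ ¬e _ → ¬e refl ; {suc _} 0F _ () ; {1F} (suc _) _ () ; {2F} (suc _) _ () })
        (λ { 0F ¬e → ¬e ; (suc _) {0F} _ () ; 1F {suc _} _ () ; 2F {suc _} _ () })
        (∈-map⁺ _ e∈) e≢0 eq

    rainbow : Rainbow G f
    rainbow u fu≡∅ with ∈-map⁻ vertex (covers u)
    ... | e , e∈ , refl with proj₁ (All.lookup valid e∈) (f-∅ e∈ fu≡∅)
    ... | p , q with find p | find q
    ... | d , d∈ , ud , cd | d′ , d′∈ , ud′ , cd′ =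
      (vertex d , ud , f₁ d∈ cd) , (vertex d′ , ud′ , f₂ d′∈ cd′)

    roman : Roman G g
    roman u gu≡0 with ∈-map⁻ vertex (covers u)
    ... | e , e∈ , refl with find (proj₂ (All.lookup valid e∈) (g-0 e∈ gu≡0))
    ... | d , d∈ , ud , rd = vertex d , ud , g₂ d∈ rd

  -- If a merged value is empty or 0, so is the proposal of any entry at that vertex. The defence of
  -- this entry then yields neighbours whose proposals survive merging, so the merged functions
  -- dominate.
  γ-sum-≤ : γr2 G + γR G ≤ weight S
  γ-sum-≤ = begin
    γr2 G + γR G                            ≤⟨ +-mono-≤ (γr2-≤ G f rainbow) (γR-≤ G g roman) ⟩
    weightR2 f + weightR g                  ≤⟨ +-mono-≤ (Colours.Σv-accumulate coloured) (Ranks.Σv-accumulate ranked) ⟩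
    sum (map (card12 ∘ proj₂) coloured) + sum (map (toℕ ∘ proj₂) ranked)
      ≡⟨ cong₂ (λ xs ys → sum xs + sum ys) (map-∘ S) (map-∘ S) ⟨
    sum (map (card12 ∘ colours) S) + sum (map (toℕ ∘ rank) S)
      ≡⟨ sum-map-+ (card12 ∘ colours) (toℕ ∘ rank) S ⟨
    weight S                                ∎
    where open ≤-Reasoning

-- Spider decompositions

∈⇒↭∷ : ∀ {x : V} {xs} → x ∈ xs → ∃[ ys ] xs ↭ x ∷ ys
∈⇒↭∷ x∈ with ∈-∃++ x∈
... | as , bs , refl = as ++ bs , shift _ as bs

unique⇒↭++ : ∀ {xs ys : List V} → Unique xs → (∀ {x} → x ∈ xs → x ∈ ys) → ∃[ zs ] ys ↭ xs ++ zs
unique⇒↭++ {xs = []}     uq       sub = _ , ↭-refl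
unique⇒↭++ {xs = x ∷ xs} {ys} (x≢ ∷ uq) sub with ∈⇒↭∷ (sub (here refl))
... | ys′ , p with unique⇒↭++ {ys = ys′} uq sub′
  where
  sub′ : ∀ {y} → y ∈ xs → y ∈ ys′
  sub′ y∈ with ∈-resp-↭ p (sub (there y∈))
  ... | here refl = contradiction refl (All.lookup x≢ y∈)
  ... | there q   = q
... | zs , q = zs , ↭-trans p (prep x q)

length-allFin : length (allFin n) ≡ n
length-allFin = length-tabulate id

unique-complete : {K : List (Fin n)} → Unique K → length K ≡ n → K ↭ allFin n
unique-complete {n} {K} uq eq with unique⇒↭++ uq (λ _ → ∈-allFin _)
... | []     , p = ↭-sym (↭-trans p (↭-reflexive (++-identityʳ K)))
... | x ∷ zs , p = contradiction
  (≡-trans (≡-sym (≡-trans (≡-sym length-allFin) (↭-length p))) (≡-sym eq))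
  λ e → m+1+n≢m (length K) (≡-trans (≡-sym (length-++ K)) e)

module _ (G : Graph n) (conn : Connected G) where

  crossing : ∀ {K u v} → u ∈ K → v ∉ K → Reach G u v →
             ∃[ x ] ∃[ y ] x ∈ K × y ∉ K × x ∼[ G ] y
  crossing u∈ v∉ here = contradiction u∈ v∉
  crossing {K} u∈ v∉ (step {v = w} uw r) with _∈?_ _≟_ w K
  ... | yes w∈ = crossing w∈ v∉ r
  ... | no w∉  = _ , w , u∈ , w∉ , uw

  boundary : ∀ {K u} → u ∈ K → length K < n → ∃[ x ] ∃[ y ] x ∈ K × y ∉ K × x ∼[ G ] y
  boundary {K} u∈ lt with all? (λ v → _∈?_ _≟_ v K)
  ... | no ¬all with ¬∀⟶∃¬ _ _ (λ v → _∈?_ _≟_ v K) ¬all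
  ... | v , v∉ = crossing u∈ v∉ (conn _ v)
  boundary {K} u∈ lt | yes all with unique⇒↭++ (allFin⁺ n) (λ {x} _ → all x)
  ... | zs , p = contradiction lt (≤⇒≯ (begin
    n                                ≤⟨ m≤m+n n (length zs) ⟩
    n + length zs                    ≡⟨ cong (_+ length zs) length-allFin ⟨
    length (allFin n) + length zs    ≡⟨ length-++ (allFin n) ⟨
    length (allFin n ++ zs)          ≡⟨ ↭-length p ⟨
    length K                         ∎))
    where open ≤-Reasoning

  fresh : ∀ {K : List (Fin n)} {y} → y ∉ K → Unique K → Unique (y ∷ K)
  fresh y∉ uq = All.tabulate (λ { z∈ refl → y∉ z∈ }) ∷ uq

  -- Induction over a connected graph by attaching one new vertex along an edge, where `m` counts
  -- the missing vertices. It serves for the spiders and again for the spanning tree on the b's.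
  grow : (P : List (Fin n) → Set) →
         (∀ {K x y} → x ∈ K → y ∉ K → x ∼[ G ] y → P K → P (y ∷ K)) →
         ∀ m {K u} → m + length K ≡ n → u ∈ K → Unique K → P K → ∃[ L ] P L × L ↭ allFin n
  grow P ext zero    eq u∈ uq pK = _ , pK , unique-complete uq eq
  grow P ext (suc m) {K} eq u∈ uq pK with boundary u∈ (subst (length K <_) eq (s≤s (m≤n+m _ m)))
  ... | x , y , x∈ , y∉ , xy =
    grow P ext m (≡-trans (+-suc m (length K)) eq) (there u∈) (fresh y∉ uq) (ext x∈ y∉ xy pK)

module _ (G : Graph n) where

  private
    _∼_ : Fin n → Fin n → Set
    u ∼ v = u ∼[ G ] v

  -- Distinctness of the vertices is not a field; it is accounted for by the permutation between the
  -- bodies and the list of all vertices.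
  record Spider : Set where
    field
      centre : Fin n
      leaves : List (Fin n)
      legs   : List (Fin n × Fin n)
      leaf-∼ : All (centre ∼_) leaves
      leg-∼  : All (λ (m , e) → centre ∼ m × m ∼ e) legs

  open Spider

  pair : Fin n × Fin n → List (Fin n)
  pair (m , e) = m ∷ e ∷ []

  body : Spider → List (Fin n)
  body s = centre s ∷ leaves s ++ concatMap pair (legs s)

  bodies : List Spider → List (Fin n)
  bodies = concatMap body

  -- Orders 1 and 2 would exceed the budget of 6/4 per vertex even with optimal functions: they cost
  -- 2 and 4, against 3/2 and 3.
  Big : Spider → Set
  Big s = 3 ≤ length (body s)

  private
    module Sol = CMSolver (++-commutativeMonoid {A = Fin n})
    open Sol using (_⊕_; _⊜_)

  concatMap-↭ : {xs ys : List (Fin n × Fin n)} → xs ↭ ys → concatMap pair xs ↭ concatMap pair ys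
  concatMap-↭ _↭_.refl         = ↭-refl
  concatMap-↭ (_↭_.prep x p)   = ++⁺ˡ (pair x) (concatMap-↭ p)
  concatMap-↭ {x ∷ y ∷ xs} (_↭_.swap _ _ p) = ↭-trans
    (++⁺ˡ (pair x) (++⁺ˡ (pair y) (concatMap-↭ p)))
    (Sol.solve 3 (λ a b c → a ⊕ (b ⊕ c) ⊜ b ⊕ (a ⊕ c)) ↭-refl (pair x) (pair y) _)
  concatMap-↭ (_↭_.trans p q)  = ↭-trans (concatMap-↭ p) (concatMap-↭ q)

  single : ∀ {v s} → Big s → (t : Spider) → body t ↭ v ∷ body s →
           ∃[ ss ] All Big ss × bodies ss ↭ v ∷ body s
  single {v} {s} big t p =
    [ t ] , (subst (3 ≤_) (≡-sym (↭-length p)) (m≤n⇒m≤1+n big) ∷ []) ,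
    ↭-trans (↭-reflexive (++-identityʳ (body t))) p

  star₂ : ∀ c {x y} → c ∼ x → c ∼ y → Spider
  star₂ c {x} {y} cx cy = record
    { centre = c ; leaves = x ∷ y ∷ [] ; legs = [] ; leaf-∼ = cx ∷ cy ∷ [] ; leg-∼ = [] }

  -- A new neighbour of a leg vertex breaks that leg off as a path of order 3, unless the rest of
  -- the spider is too small to survive; then the whole is a spider around another centre.
  extend-leg : ∀ (s : Spider) {m e v} → Big s → (l : (m , e) ∈ legs s) → m ∼ v ⊎ e ∼ v →
               ∃[ ss ] All Big ss × bodies ss ↭ v ∷ body s
  extend-leg s@record { centre = c ; leaves = ls ; legs = gs ; leaf-∼ = ls∼ ; leg-∼ = gs∼ }
             {m} {e} {v} big l adj
    with ∈⇒↭∷ l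
  ... | gs′ , p with All-resp-↭ p gs∼
  ... | (cm , me) ∷ gs′∼ = result ls ls∼ gs′ gs′∼ (concatMap-↭ p) big adj (3 ≤? _)
    where
    result : ∀ ls (ls∼ : All (c ∼_) ls) gs′ (gs′∼ : All (λ (m , e) → c ∼ m × m ∼ e) gs′) →
             concatMap pair gs ↭ m ∷ e ∷ concatMap pair gs′ →
             3 ≤ length (c ∷ ls ++ concatMap pair gs) → m ∼ v ⊎ e ∼ v →
             Dec (3 ≤ length (c ∷ ls ++ concatMap pair gs′)) →
             ∃[ ss ] All Big ss × bodies ss ↭ v ∷ c ∷ ls ++ concatMap pair gs
    -- Without the leg only `c`, or `c` and one leaf `x`, would be left. In all four cases the whole
    -- is a spider around `m`.
    result [] _ [] _ p big (inj₁ mv) (no _) = single {s = record s { leaves = [] ; leaf-∼ = [] }} big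
      (record { centre = m ; leaves = c ∷ e ∷ v ∷ [] ; legs = []
              ; leaf-∼ = ∼-sym G cm ∷ me ∷ mv ∷ [] ; leg-∼ = [] })
      (↭-trans (Sol.solve 4 (λ m c e v → m ⊕ (c ⊕ (e ⊕ v)) ⊜ v ⊕ (c ⊕ (m ⊕ e))) ↭-refl
                 [ m ] [ c ] [ e ] [ v ])
               (prep v (prep c (↭-sym p))))
    result [] _ [] _ p big (inj₂ ev) (no _) = single {s = record s { leaves = [] ; leaf-∼ = [] }} big
      (record { centre = m ; leaves = c ∷ [] ; legs = (e , v) ∷ []
              ; leaf-∼ = ∼-sym G cm ∷ [] ; leg-∼ = (me , ev) ∷ [] })
      (↭-trans (Sol.solve 4 (λ m c e v → m ⊕ (c ⊕ (e ⊕ v)) ⊜ v ⊕ (c ⊕ (m ⊕ e))) ↭-refl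
                 [ m ] [ c ] [ e ] [ v ])
               (prep v (prep c (↭-sym p))))
    result (x ∷ []) ls∼@(cx ∷ []) [] _ p big (inj₁ mv) (no _) =
      single {s = record s { leaves = x ∷ [] ; leaf-∼ = ls∼ }} big
      (record { centre = m ; leaves = e ∷ v ∷ [] ; legs = (c , x) ∷ []
              ; leaf-∼ = me ∷ mv ∷ [] ; leg-∼ = (∼-sym G cm , cx) ∷ [] })
      (↭-trans (Sol.solve 5 (λ m c e v x → m ⊕ (e ⊕ (v ⊕ (c ⊕ x))) ⊜ v ⊕ (c ⊕ (x ⊕ (m ⊕ e)))) ↭-refl
                 [ m ] [ c ] [ e ] [ v ] [ x ])
               (prep v (prep c (prep x (↭-sym p)))))
    result (x ∷ []) ls∼@(cx ∷ []) [] _ p big (inj₂ ev) (no _) =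
      single {s = record s { leaves = x ∷ [] ; leaf-∼ = ls∼ }} big
      (record { centre = m ; leaves = [] ; legs = (c , x) ∷ (e , v) ∷ []
              ; leaf-∼ = [] ; leg-∼ = (∼-sym G cm , cx) ∷ (me , ev) ∷ [] })
      (↭-trans (Sol.solve 5 (λ m c e v x → m ⊕ (c ⊕ (x ⊕ (e ⊕ v))) ⊜ v ⊕ (c ⊕ (x ⊕ (m ⊕ e)))) ↭-refl
                 [ m ] [ c ] [ e ] [ v ] [ x ])
               (prep v (prep c (prep x (↭-sym p)))))
    result [] _ (_ ∷ _) _ p big _ (no ¬big) = contradiction (s≤s (s≤s (s≤s z≤n))) ¬big
    result (_ ∷ []) _ (_ ∷ _) _ p big _ (no ¬big) = contradiction (s≤s (s≤s (s≤s z≤n))) ¬big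
    result (_ ∷ _ ∷ _) _ _ _ p big _ (no ¬big) = contradiction (s≤s (s≤s (s≤s z≤n))) ¬big
    result ls ls∼ gs′ gs′∼ p big adj (yes rest-big) = split adj
      where
      rest : Spider
      rest = record { centre = c ; leaves = ls ; legs = gs′ ; leaf-∼ = ls∼ ; leg-∼ = gs′∼ }
      rearrange : ∀ xs → xs ↭ v ∷ m ∷ e ∷ [] →
                  xs ++ body rest ++ [] ↭ v ∷ c ∷ ls ++ concatMap pair gs
      rearrange xs q = ↭-trans (++⁺ʳ _ q) (↭-trans
        (Sol.solve 6 (λ v m e c l g → (v ⊕ (m ⊕ e)) ⊕ ((c ⊕ (l ⊕ g)) ⊕ Sol.id) ⊜ v ⊕ (c ⊕ (l ⊕ (m ⊕ (e ⊕ g)))))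
          ↭-refl [ v ] [ m ] [ e ] [ c ] ls (concatMap pair gs′))
        (prep v (prep c (++⁺ˡ ls (↭-sym p)))))
      split : m ∼ v ⊎ e ∼ v → ∃[ ss ] All Big ss × bodies ss ↭ v ∷ c ∷ ls ++ concatMap pair gs
      split (inj₁ mv) = star₂ m me mv ∷ rest ∷ [] , (≤-refl ∷ rest-big ∷ []) ,
        rearrange (m ∷ e ∷ v ∷ [])
          (Sol.solve 3 (λ m e v → m ⊕ (e ⊕ v) ⊜ v ⊕ (m ⊕ e)) ↭-refl [ m ] [ e ] [ v ])
      split (inj₂ ev) = star₂ e (∼-sym G me) ev ∷ rest ∷ [] , (≤-refl ∷ rest-big ∷ []) ,
        rearrange (e ∷ m ∷ v ∷ [])
          (Sol.solve 3 (λ m e v → e ⊕ (m ⊕ v) ⊜ v ⊕ (m ⊕ e)) ↭-refl [ m ] [ e ] [ v ])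

  -- A neighbour of the centre becomes a leaf and a neighbour of a leaf turns that leaf into a leg,
  -- so only neighbours of leg vertices can force a split.
  extend : ∀ s {u v} → Big s → u ∈ body s → u ∼ v → ∃[ ss ] All Big ss × bodies ss ↭ v ∷ body s
  extend s {v = v} big (here refl) uv = single {s = s} big
    (record s { leaves = v ∷ leaves s ; leaf-∼ = uv ∷ leaf-∼ s }) (swap _ _ ↭-refl)
  extend s@record { centre = c ; leaves = ls ; legs = gs } {u} {v} big (there u∈) uv
    with ∈-++⁻ ls u∈
  ... | inj₁ l with ∈⇒↭∷ l
  ... | ls′ , p with All-resp-↭ p (leaf-∼ s)
  ... | cu ∷ ls′∼ = single {s = s} big
    (record { centre = c ; leaves = ls′ ; legs = (u , v) ∷ gs ; leaf-∼ = ls′∼ ; leg-∼ = (cu , uv) ∷ leg-∼ s })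
    (↭-trans
      (Sol.solve 5 (λ c l u v g → c ⊕ (l ⊕ (u ⊕ (v ⊕ g))) ⊜ v ⊕ (c ⊕ ((u ⊕ l) ⊕ g))) ↭-refl
        [ c ] ls′ [ u ] [ v ] (concatMap pair gs))
      (prep v (prep c (++⁺ʳ _ (↭-sym p)))))
  extend s {u} {v} big (there u∈) uv | inj₂ g with find (∈-concatMap⁻ pair {xs = legs s} g)
  ... | (m , e) , l , here refl         = extend-leg s big l (inj₁ uv)
  ... | (m , e) , l , there (here refl) = extend-leg s big l (inj₂ uv)

  extend-bodies : ∀ ss {u v} → All Big ss → u ∈ bodies ss → u ∼ v →
                  ∃[ ts ] All Big ts × bodies ts ↭ v ∷ bodies ss
  extend-bodies (s ∷ ss) {v = v} (big ∷ bigs) u∈ uv with ∈-++⁻ (body s) u∈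
  ... | inj₁ u∈s with extend s big u∈s uv
  ... | ts , ts-big , p =
    ts ++ ss , All.++⁺ ts-big bigs ,
    ↭-trans (↭-reflexive (concatMap-++ body ts ss)) (++⁺ʳ (bodies ss) p)
  extend-bodies (s ∷ ss) {v = v} (big ∷ bigs) u∈ uv | inj₂ u∈ss with extend-bodies ss bigs u∈ss uv
  ... | ts , ts-big , p =
    s ∷ ts , big ∷ ts-big , ↭-trans (++⁺ˡ (body s) p) (shift v (body s) (bodies ss))

  initial-path : Connected G → 3 ≤ n →
                 ∃[ K ] Unique K × length K ≡ 3 × (∃[ s ] body s ↭ K)
  initial-path conn (s≤s (s≤s (s≤s _))) with boundary G conn {K = [ zero ]} (here refl) (s≤s (s≤s z≤n))
  ... | u , v , here refl , v∉ , uv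
    with boundary G conn {K = v ∷ u ∷ []} (here refl) (s≤s (s≤s (s≤s z≤n)))
  ... | _ , w , there (here refl) , w∉ , uw =
    w ∷ v ∷ u ∷ [] , fresh G conn w∉ (fresh G conn v∉ ([] ∷ [])) , refl , star₂ u uw uv ,
    Sol.solve 3 (λ u v w → u ⊕ (w ⊕ v) ⊜ w ⊕ (v ⊕ u)) ↭-refl [ u ] [ v ] [ w ]
  ... | _ , w , here refl , w∉ , vw =
    w ∷ v ∷ u ∷ [] , fresh G conn w∉ (fresh G conn v∉ ([] ∷ [])) , refl , star₂ v vw (∼-sym G uv) ,
    Sol.solve 3 (λ u v w → v ⊕ (w ⊕ u) ⊜ w ⊕ (v ⊕ u)) ↭-refl [ u ] [ v ] [ w ]

  spider-decomposition : Connected G → 3 ≤ n → ∃[ ss ] All Big ss × bodies ss ↭ allFin n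
  spider-decomposition conn 3≤n with initial-path conn 3≤n
  ... | K@(u ∷ _) , uq , len , s , p
    with grow G conn (λ K → ∃[ ss ] All Big ss × bodies ss ↭ K) ext (n ∸ 3)
           (≡-trans (cong (n ∸ 3 +_) len) (m∸n+n≡m 3≤n)) (here refl) uq
           ([ s ] , (≤-reflexive (≡-sym (≡-trans (↭-length p) len)) ∷ []) ,
            ↭-trans (↭-reflexive (++-identityʳ (body s))) p)
    where
    ext : ∀ {K x y} → x ∈ K → y ∉ K → x ∼ y →
          ∃[ ss ] All Big ss × bodies ss ↭ K → ∃[ ss ] All Big ss × bodies ss ↭ y ∷ K
    ext x∈ _ xy (ss , big , p) with extend-bodies ss big (∈-resp-↭ (↭-sym p) x∈) xy
    ... | ts , ts-big , q = ts , ts-big , ↭-trans q (prep _ p)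
  ... | L , (ss , big , q) , r = ss , big , ↭-trans q r

-- The cost of spiders and the resulting path covers

module _ (G : Graph n) where

  private
    _∼_ : Fin n → Fin n → Set
    u ∼ v = u ∼[ G ] v

  open Spider

  IsPath : (Fin 4 → Fin n) → Set
  IsPath q = q 0F ∼ q 1F × q 1F ∼ q 2F × q 2F ∼ q 3F

  -- Disjointness is encoded by counting: if `vs` has no repetitions, paths that cover it and have
  -- only `length vs` positions in total cannot overlap.
  PathCover : List (Fin n) → List (Fin 4 → Fin n) → Set
  PathCover vs qs = All IsPath qs × (∀ {v} → v ∈ vs → Any (λ q → ∃[ p ] q p ≡ v) qs)
                    × length vs ≡ length qs * 4

  Economical : List (Fin n) → Set
  Economical vs =
    ∃[ S ] Valid _∼_ S × (∀ {v} → v ∈ vs → v ∈ vertices S)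
           × (4 * weight S < 6 * length vs ⊎ 4 * weight S ≡ 6 * length vs × ∃ (PathCover vs))

  economical-↭ : ∀ {us vs} → us ↭ vs → Economical us → Economical vs
  economical-↭ p (S , valid , cov , w) rewrite ↭-length p =
    S , valid , (λ v∈ → cov (∈-resp-↭ (↭-sym p) v∈)) , w′ w
    where
    w′ : _ ⊎ _ → _ ⊎ _
    w′ (inj₁ lt) = inj₁ lt
    w′ (inj₂ (eq , qs , paths , qcov , len)) =
      inj₂ (eq , qs , paths , (λ v∈ → qcov (∈-resp-↭ (↭-sym p) v∈)) , len)

  economical-[] : Economical []
  economical-[] = [] , [] , (λ ()) , inj₂ (refl , [] , [] , (λ ()) , refl)

  -- One strict summand makes the sum strict, so equality remains only if both parts have path
  -- covers, and these are concatenated.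
  economical-++ : ∀ us {vs} → Economical us → Economical vs → Economical (us ++ vs)
  economical-++ us {vs} (S , vS , cS , wS) (T , vT , cT , wT) =
    S ++ T , valid-++ _∼_ vS vT , cover ,
    subst (λ l → 4 * weight (S ++ T) < 6 * l ⊎ 4 * weight (S ++ T) ≡ 6 * l × ∃ (PathCover (us ++ vs)))
          (≡-sym (length-++ us))
    (subst (λ w → 4 * w < 6 * (length us + length vs) ⊎
                  4 * w ≡ 6 * (length us + length vs) × ∃ (PathCover (us ++ vs)))
          (≡-sym (weight-++ S T)) (add wS wT))
    where
    cover : ∀ {v} → v ∈ us ++ vs → v ∈ vertices (S ++ T)
    cover v∈ rewrite map-++ vertex S T with ∈-++⁻ us v∈
    ... | inj₁ v∈us = ∈-++⁺ˡ (cS v∈us)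
    ... | inj₂ v∈vs = ∈-++⁺ʳ (vertices S) (cT v∈vs)
    distrib : ∀ k a b → k * a + k * b ≡ k * (a + b)
    distrib k a b = ≡-sym (*-distribˡ-+ k a b)
    less : 4 * weight S + 4 * weight T < 6 * length us + 6 * length vs →
           4 * (weight S + weight T) < 6 * (length us + length vs)
    less = subst₂ _<_ (distrib 4 (weight S) (weight T)) (distrib 6 (length us) (length vs))
    add : 4 * weight S < 6 * length us ⊎ 4 * weight S ≡ 6 * length us × ∃ (PathCover us) →
          4 * weight T < 6 * length vs ⊎ 4 * weight T ≡ 6 * length vs × ∃ (PathCover vs) →
          4 * (weight S + weight T) < 6 * (length us + length vs) ⊎
          4 * (weight S + weight T) ≡ 6 * (length us + length vs) × ∃ (PathCover (us ++ vs))
    add (inj₁ l) (inj₁ m)       = inj₁ (less (+-mono-< l m))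
    add (inj₁ l) (inj₂ (m , _)) = inj₁ (less (+-mono-<-≤ l (≤-reflexive m)))
    add (inj₂ (l , _)) (inj₁ m) = inj₁ (less (+-mono-≤-< (≤-reflexive l) m))
    add (inj₂ (l , qs , pq , cq , lq)) (inj₂ (m , rs , pr , cr , lr)) =
      inj₂ (≡-trans (≡-sym (distrib 4 (weight S) _)) (≡-trans (cong₂ _+_ l m) (distrib 6 (length us) _)) ,
            qs ++ rs , All.++⁺ pq pr , qcover ,
            ≡-trans (length-++ us) (≡-trans (cong₂ _+_ lq lr)
              (≡-trans (≡-sym (*-distribʳ-+ 4 (length qs) (length rs))) (cong (_* 4) (≡-sym (length-++ qs))))))
      where
      qcover : ∀ {v} → v ∈ us ++ vs → Any (λ q → ∃[ p ] q p ≡ v) (qs ++ rs)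
      qcover v∈ with ∈-++⁻ us v∈
      ... | inj₁ v∈us = Any.++⁺ˡ (cq v∈us)
      ... | inj₂ v∈vs = Any.++⁺ʳ qs (cr v∈vs)

  legEntries : Fin n × Fin n → Config (Fin n)
  legEntries (m , e) = (m , ∅ , 0F) ∷ (e , (true , false) , 1F) ∷ []

  config : Spider G → Config (Fin n)
  config s = (centre s , full , 2F) ∷ map (λ x → x , ∅ , 0F) (leaves s) ++ concatMap legEntries (legs s)

  config-valid : ∀ s → Valid _∼_ (config s)
  config-valid s =
    ((λ ()) , λ ()) ∷
    All.++⁺ (All.map⁺ (All.map (guarded ∘ ∼-sym G) (leaf-∼ s)))
            (All.concat⁺ (All.map⁺ (All.map (λ { (cm , _) → guarded (∼-sym G cm) ∷ ((λ ()) , λ ()) ∷ [] })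
                                            (leg-∼ s))))
    where
    guarded : ∀ {x} → x ∼ centre s → Defended _∼_ (config s) (x , ∅ , 0F)
    guarded xc = (λ _ → here (xc , refl) , here (xc , refl)) , λ _ → here (xc , refl)

  config-vertices : ∀ s → vertices (config s) ≡ body G s
  config-vertices s = cong (centre s ∷_) (begin
    map vertex (map _ (leaves s) ++ concatMap legEntries (legs s))
      ≡⟨ map-++ vertex (map _ (leaves s)) _ ⟩
    map vertex (map _ (leaves s)) ++ map vertex (concatMap legEntries (legs s))
      ≡⟨ cong₂ _++_ (≡-trans (≡-sym (map-∘ (leaves s))) (map-id (leaves s))) (legs-vertices (legs s)) ⟩
    leaves s ++ concatMap (pair G) (legs s) ∎)
    where
    open ≡-Reasoning
    legs-vertices : ∀ gs → map vertex (concatMap legEntries gs) ≡ concatMap (pair G) gs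
    legs-vertices []       = refl
    legs-vertices (g ∷ gs) = cong (λ vs → proj₁ g ∷ proj₂ g ∷ vs) (legs-vertices gs)

  config-weight : ∀ s → weight (config s) ≡ 4 + 2 * length (legs s)
  config-weight s = cong (4 +_) (begin
    weight (map (λ x → x , ∅ , 0F) (leaves s) ++ concatMap legEntries (legs s))
      ≡⟨ weight-++ (map _ (leaves s)) _ ⟩
    weight (map (λ x → x , ∅ , 0F) (leaves s)) + weight (concatMap legEntries (legs s))
      ≡⟨ cong₂ _+_ (leaves-weight (leaves s)) (legs-weight (legs s)) ⟩
    2 * length (legs s) ∎)
    where
    open ≡-Reasoning
    leaves-weight : ∀ ls → weight (map (λ x → x , ∅ , 0F) ls) ≡ 0
    leaves-weight []       = refl
    leaves-weight (_ ∷ ls) = leaves-weight ls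
    legs-weight : ∀ gs → weight (concatMap legEntries gs) ≡ 2 * length gs
    legs-weight []       = refl
    legs-weight (g ∷ gs) = ≡-trans (cong (2 +_) (legs-weight gs)) (≡-sym (*-suc 2 (length gs)))

  length-body : ∀ s → length (body G s) ≡ 1 + (length (leaves s) + 2 * length (legs s))
  length-body s = cong suc
    (≡-trans (length-++ (leaves s)) (cong (length (leaves s) +_) (legs-length (legs s))))
    where
    legs-length : ∀ gs → length (concatMap (pair G) gs) ≡ 2 * length gs
    legs-length []       = refl
    legs-length (g ∷ gs) = ≡-trans (cong (2 +_) (legs-length gs)) (≡-sym (*-suc 2 (length gs)))

  -- With l leaves and t legs, 4(4 + 2t) < 6(1 + l + 2t) amounts to 6l + 4t ≥ 11; `d` is the slack.
  centred : ∀ s d → 6 * length (leaves s) + 4 * length (legs s) ≡ 11 + d → Economical (body G s)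
  centred s d eq =
    config s , config-valid s , (λ {v} → subst (v ∈_) (≡-sym (config-vertices s))) , inj₁ (begin-strict
    4 * weight (config s)                  ≡⟨ cong (4 *_) (config-weight s) ⟩
    4 * (4 + 2 * t)                        <⟨ m≤m+n _ d ⟩
    1 + 4 * (4 + 2 * t) + d                ≡⟨ lhs t d ⟩
    (11 + d) + (6 + 8 * t)                 ≡⟨ cong (_+ (6 + 8 * t)) eq ⟨
    (6 * l + 4 * t) + (6 + 8 * t)          ≡⟨ rhs l t ⟩
    6 * (1 + (l + 2 * t))                  ≡⟨ cong (6 *_) (length-body s) ⟨
    6 * length (body G s)                  ∎)
    where
    open ≤-Reasoning
    l t : ℕ
    l = length (leaves s)
    t = length (legs s)
    lhs : ∀ t d → 1 + 4 * (4 + 2 * t) + d ≡ (11 + d) + (6 + 8 * t)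
    lhs = solve-∀
    rhs : ∀ l t → (6 * l + 4 * t) + (6 + 8 * t) ≡ 6 * (1 + (l + 2 * t))
    rhs = solve-∀

  -- Among spiders of order at least 3, the criterion 6l + 4t ≥ 11 fails only for (l, t) = (0, 1),
  -- (1, 1) and (0, 2), the paths of orders 3, 4 and 5. The first one passes as a star around its
  -- middle vertex, where 12 = 11 + 1.
  economical-spider : ∀ s → Big G s → Economical (body G s)
  economical-spider record { leaves = [] ; legs = [] } (s≤s ())
  economical-spider record { leaves = _ ∷ [] ; legs = [] } (s≤s (s≤s ()))
  economical-spider s@record { leaves = _ ∷ _ ∷ ls ; legs = gs } _ =
    centred s (1 + 6 * length ls + 4 * length gs) (lemma (length ls) (length gs))
    where
    lemma : ∀ l t → 6 * (2 + l) + 4 * t ≡ 11 + (1 + 6 * l + 4 * t)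
    lemma = solve-∀
  economical-spider s@record { leaves = [] ; legs = _ ∷ _ ∷ _ ∷ gs } _ =
    centred s (1 + 4 * length gs) (lemma (length gs))
    where
    lemma : ∀ t → 6 * 0 + 4 * (3 + t) ≡ 11 + (1 + 4 * t)
    lemma = solve-∀
  economical-spider s@record { leaves = _ ∷ [] ; legs = _ ∷ _ ∷ gs } _ =
    centred s (3 + 4 * length gs) (lemma (length gs))
    where
    lemma : ∀ t → 6 * 1 + 4 * (2 + t) ≡ 11 + (3 + 4 * t)
    lemma = solve-∀
  economical-spider record { centre = c ; leaves = [] ; legs = (m , e) ∷ [] ; leg-∼ = (cm , me) ∷ [] } _ =
    economical-↭ (swap m c ↭-refl) (centred (star₂ G m (∼-sym G cm) me) 1 refl)
  economical-spider s@record { centre = c ; leaves = x ∷ [] ; legs = (m , e) ∷ []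
                             ; leaf-∼ = cx ∷ [] ; leg-∼ = (cm , me) ∷ [] } _ =
    config s , config-valid s , id ,
    inj₂ (refl , q ∷ [] , (∼-sym G cx , cm , me) ∷ [] , (λ v∈ → here (onto v∈)) , refl)
    where
    q : Fin 4 → Fin n
    q 0F = x
    q 1F = c
    q 2F = m
    q 3F = e
    onto : ∀ {v} → v ∈ c ∷ x ∷ m ∷ e ∷ [] → ∃[ p ] q p ≡ v
    onto (here refl)                         = 1F , refl
    onto (there (here refl))                 = 0F , refl
    onto (there (there (here refl)))         = 2F , refl
    onto (there (there (there (here refl)))) = 3F , refl
  -- For P₅ the centre rule has total weight 8; alternating the colours saves one.
  economical-spider s@record { centre = c ; leaves = [] ; legs = (m , e) ∷ (m′ , e′) ∷ []
                             ; leg-∼ = (cm , me) ∷ (cm′ , me′) ∷ [] } _ =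
    S , valid , id , inj₁ (m≤m+n 29 1)
    where
    S : Config (Fin n)
    S = (c , (false , true) , 2F) ∷ (m , ∅ , 0F) ∷ (e , (true , false) , 1F)
        ∷ (m′ , ∅ , 0F) ∷ (e′ , (true , false) , 1F) ∷ []
    valid : Valid _∼_ S
    valid = ((λ ()) , λ ())
          ∷ ((λ _ → there (there (here (me , refl))) , here (∼-sym G cm , refl)) ,
             λ _ → here (∼-sym G cm , refl))
          ∷ ((λ ()) , λ ())
          ∷ ((λ _ → there (there (there (there (here (me′ , refl))))) , here (∼-sym G cm′ , refl)) ,
             λ _ → here (∼-sym G cm′ , refl))
          ∷ ((λ ()) , λ ())
          ∷ []

  economical-bodies : ∀ ss → All (Big G) ss → Economical (bodies G ss)
  economical-bodies []       []           = economical-[]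
  economical-bodies (s ∷ ss) (big ∷ bigs) =
    economical-++ (body G s) (economical-spider s big) (economical-bodies ss bigs)

  economical-allFin : Connected G → 3 ≤ n → Economical (allFin n)
  economical-allFin conn 3≤n with spider-decomposition G conn 3≤n
  ... | ss , big , p = economical-↭ p (economical-bodies ss big)

-- Tilings by paths of order 4

turn : Bool → Fin 4 → Fin 4
turn false p = p
turn true  p = opposite p

turn-involutive : ∀ o p → turn o (turn o p) ≡ p
turn-involutive false p = refl
turn-involutive true  p = opposite-involutive p

Next : Fin 4 → Fin 4 → Set
Next p q = suc (toℕ p) ≡ toℕ q ⊎ suc (toℕ q) ≡ toℕ p

next? : ∀ p q → Dec (Next p q)
next? p q = (suc (toℕ p) ℕ.≟ toℕ q) ⊎-dec (suc (toℕ q) ℕ.≟ toℕ p)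

consecutive : ∀ p q → suc (toℕ p) ≡ toℕ q →
              (p ≡ 0F × q ≡ 1F) ⊎ (p ≡ 1F × q ≡ 2F) ⊎ (p ≡ 2F × q ≡ 3F)
consecutive = from-yes (all? λ (p : Fin 4) → all? λ (q : Fin 4) → (suc (toℕ p) ℕ.≟ toℕ q) →-dec
  (((p ≟ 0F) ×-dec (q ≟ 1F)) ⊎-dec ((p ≟ 1F) ×-dec (q ≟ 2F)) ⊎-dec ((p ≟ 2F) ×-dec (q ≟ 3F))))

-- A section `s` of `f` is injective. If it missed some `x`, punching out `x` would inject
-- `Fin (suc m)` into `Fin m`; so `s` is onto, and `f` is its two-sided inverse.
surjective⇒injective : ∀ {m n} → m ≡ n → (f : Fin m → Fin n) → (∀ y → ∃[ x ] f x ≡ y) →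
                       ∀ {x y} → f x ≡ f y → x ≡ y
surjective⇒injective {suc m} refl f onto {x} {y} eq = begin
  x            ≡⟨ proj₂ (hit x) ⟨
  s (inv x)    ≡⟨ cong s (section-inv x) ⟩
  s (f x)      ≡⟨ cong s eq ⟩
  s (f y)      ≡⟨ cong s (section-inv y) ⟨
  s (inv y)    ≡⟨ proj₂ (hit y) ⟩
  y            ∎
  where
  open ≡-Reasoning
  s : Fin (suc m) → Fin (suc m)
  s y = proj₁ (onto y)
  s-injective : ∀ {a b} → s a ≡ s b → a ≡ b
  s-injective {a} {b} e = ≡-trans (≡-sym (proj₂ (onto a))) (≡-trans (cong f e) (proj₂ (onto b)))
  hit : ∀ x → ∃[ y ] s y ≡ x
  hit x with any? (λ y → s y ≟ x)
  ... | yes h = h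
  ... | no ¬h = contradiction
    (injective⇒≤ {f = λ y → punchOut {i = x} {j = s y} (λ e → ¬h (y , ≡-sym e))}
                 (λ e → s-injective (punchOut-injective {i = x} _ _ e)))
    (<⇒≱ (n<1+n m))
  inv : Fin (suc m) → Fin (suc m)
  inv x = proj₁ (hit x)
  section-inv : ∀ x → inv x ≡ f x
  section-inv x = ≡-trans (≡-sym (proj₂ (onto (inv x)))) (cong f (proj₂ (hit x)))

record Tiling (G : Graph n) (k : ℕ) : Set where
  field
    tile : Fin k → Fin 4 → Fin n
    path : ∀ i → IsPath G (tile i)
    onto : ∀ v → ∃[ i ] ∃[ p ] tile i p ≡ v
    size : n ≡ k * 4

  tile-∼ : ∀ o i p q → suc (toℕ p) ≡ toℕ q → tile i (turn o p) ∼[ G ] tile i (turn o q)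
  tile-∼ o i p q e with path i | consecutive p q e
  tile-∼ false i _ _ _ | ab , _  , _  | inj₁ (refl , refl)        = ab
  tile-∼ false i _ _ _ | _  , bc , _  | inj₂ (inj₁ (refl , refl)) = bc
  tile-∼ false i _ _ _ | _  , _  , cd | inj₂ (inj₂ (refl , refl)) = cd
  tile-∼ true  i _ _ _ | _  , _  , cd | inj₁ (refl , refl)        = ∼-sym G cd
  tile-∼ true  i _ _ _ | _  , bc , _  | inj₂ (inj₁ (refl , refl)) = ∼-sym G bc
  tile-∼ true  i _ _ _ | ab , _  , _  | inj₂ (inj₂ (refl , refl)) = ∼-sym G ab

  abstract
    -- The `k * 4` positions cover all `n = k * 4` vertices, so no vertex is covered twice.
    tile-injective : ∀ {i j p q} → tile i p ≡ tile j q → i ≡ j × p ≡ q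
    tile-injective {i} {j} {p} {q} eq = combine-injective i p j q
      (surjective⇒injective (≡-sym size) f f-onto
        (≡-trans (f-combine i p) (≡-trans eq (≡-sym (f-combine j q)))))
      where
      f : Fin (k * 4) → Fin n
      f x = uncurry tile (remQuot 4 x)
      f-combine : ∀ i p → f (combine i p) ≡ tile i p
      f-combine i p = cong (uncurry tile) (remQuot-combine i p)
      f-onto : ∀ y → ∃[ x ] f x ≡ y
      f-onto y with onto y
      ... | i , p , e = combine i p , ≡-trans (f-combine i p) e

paths⇒tiling : (G : Graph n) → ∀ {vs} → (∀ v → v ∈ vs) → length vs ≡ n → ∃ (PathCover G vs) →
                  ∃ (Tiling G)
paths⇒tiling G full len (qs , paths , cov , size) = length qs , record
  { tile = lookup qs
  ; path = λ i → All.lookup paths (∈-lookup i)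
  ; onto = λ v → let c = cov (full v) in Any.index c , Any.lookup-index c
  ; size = ≡-trans (≡-sym len) size
  }

-- Templates and local exchanges

Pos : ℕ → Set
Pos m = Fin m × Fin 4

-- Paths a₁b₁c₁d₁, …, aₘbₘcₘdₘ together with the list X of extra edges.
Template : List (Pos m × Pos m) → Pos m → Pos m → Set
Template X x y = PathEdge x y ⊎ (x , y) ∈ X ⊎ (y , x) ∈ X

_≟ₚ_ : DecidableEquality (Pos m)
_≟ₚ_ = ≡-dec _≟_ _≟_

template? : (X : List (Pos m × Pos m)) → ∀ x y → Dec (Template X x y)
template? X x y =
  ((proj₁ x ≟ proj₁ y) ×-dec next? (proj₂ x) (proj₂ y))
  ⊎-dec (_∈?_ (≡-dec _≟ₚ_ _≟ₚ_) (x , y) X ⊎-dec _∈?_ (≡-dec _≟ₚ_ _≟ₚ_) (y , x) X)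

-- The threshold `6 * m` is the weight of `standard` on `m` tiles. For closed `X` and `S` the
-- property is settled by evaluation, so each exchange below passes its proof as `_`.
Improves : List (Pos m × Pos m) → Config (Pos m) → Set
Improves {m} X S = Valid (Template X) S × (∀ i p → (i , p) ∈ vertices S) × weight S < 6 * m

improves? : (X : List (Pos m × Pos m)) (S : Config (Pos m)) → Dec (Improves X S)
improves? {m} X S = valid? (template? X) S
  ×-dec (all? λ i → all? λ p → _∈?_ _≟ₚ_ (i , p) (vertices S)) ×-dec (suc (weight S) ℕ.≤? 6 * m)

module Rigidity (G : Graph n) (extremal : 6 * n ≤ 4 * (γr2 G + γR G)) (T : Tiling G k) where
  open Tiling T

  private
    _∼_ : Fin n → Fin n → Set
    u ∼ v = u ∼[ G ] v

  -- The configuration of the spider with centre b, leaf a and leg (c, d). Its weight 6 is exactly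
  -- the share of four vertices.
  standard : Config (Fin 4)
  standard = (0F , ∅ , 0F) ∷ (1F , full , 2F) ∷ (2F , ∅ , 0F) ∷ (3F , (true , false) , 1F) ∷ []

  standardAt : Fin k → Config (Fin n)
  standardAt i = map (map₁ (tile i)) standard

  standardAt-valid : ∀ i → Valid _∼_ (standardAt i)
  standardAt-valid i with path i
  ... | ab , bc , cd =
    ((λ _ → there (here (ab , refl)) , there (here (ab , refl))) , λ _ → there (here (ab , refl)))
    ∷ ((λ ()) , λ ())
    ∷ ((λ _ → there (here (∼-sym G bc , refl)) , there (here (∼-sym G bc , refl))) ,
       λ _ → there (here (∼-sym G bc , refl)))
    ∷ ((λ ()) , λ ())
    ∷ []

  -- Unless this is abstract, with-abstraction over its consequences unfolds improves?.
  abstract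
    no-improvement : (ix : Fin m → Fin k) → (∀ {a b} → ix a ≡ ix b → a ≡ b) → (o : Fin m → Bool) →
                     (X : List (Pos m × Pos m)) (S : Config (Pos m)) → True (improves? X S) →
                     ¬ All (λ (x , y) → tile (ix (proj₁ x)) (turn (o (proj₁ x)) (proj₂ x))
                                      ∼ tile (ix (proj₁ y)) (turn (o (proj₁ y)) (proj₂ y))) X
    no-improvement {m} ix ix-injective o X S ok X∼
      with toWitness {a? = improves? X S} ok
         | unique⇒↭++ {ys = allFin k} (tabulate⁺ ix-injective) (λ _ → ∈-allFin _)
    ... | S-valid , S-covers , S-light | rest , split =
      -- The `r` tiles outside the template keep `standard` at 6 each, so `24 * r` occurs on both
      -- sides; cancelling it leaves `6 * m ≤ weight S`.
      contradiction S-light (≤⇒≯ (*-cancelˡ-≤ 4 (+-cancelʳ-≤ (24 * r) _ _ (begin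
        4 * (6 * m) + 24 * r              ≡⟨ lhs m r ⟩
        6 * ((m + r) * 4)                 ≡⟨ cong (λ j → 6 * (j * 4)) k≡ ⟨
        6 * (k * 4)                       ≡⟨ cong (6 *_) size ⟨
        6 * n                             ≤⟨ extremal ⟩
        4 * (γr2 G + γR G)                ≤⟨ *-monoʳ-≤ 4 (γ-sum-≤ G whole whole-valid whole-covers) ⟩
        4 * weight whole                  ≡⟨ cong (4 *_) whole-weight ⟩
        4 * (weight S + 6 * r)            ≡⟨ rhs (weight S) r ⟩
        4 * weight S + 24 * r             ∎))))
      where
      open ≤-Reasoning
      r : ℕ
      r = length rest
      lhs : ∀ m r → 4 * (6 * m) + 24 * r ≡ 6 * ((m + r) * 4)
      lhs = solve-∀
      rhs : ∀ w r → 4 * (w + 6 * r) ≡ 4 * w + 24 * r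
      rhs = solve-∀
      k≡ : k ≡ m + r
      k≡ = ≡-trans (≡-sym length-allFin) (≡-trans (↭-length split)
             (≡-trans (length-++ (tabulate ix)) (cong (_+ r) (length-tabulate ix))))
      place : Pos m → Fin n
      place (a , p) = tile (ix a) (turn (o a) p)
      place-∼ : ∀ {x y} → Template X x y → place x ∼ place y
      place-∼ {a , p} {_ , q} (inj₁ (refl , inj₁ e)) = tile-∼ (o a) (ix a) p q e
      place-∼ {a , p} {_ , q} (inj₁ (refl , inj₂ e)) = ∼-sym G (tile-∼ (o a) (ix a) q p e)
      place-∼ (inj₂ (inj₁ e)) = All.lookup X∼ e
      place-∼ (inj₂ (inj₂ e)) = ∼-sym G (All.lookup X∼ e)
      others whole : Config (Fin n)
      others = concatMap standardAt rest
      whole  = map (map₁ place) S ++ others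
      others-valid : ∀ is → Valid _∼_ (concatMap standardAt is)
      others-valid []       = []
      others-valid (i ∷ is) = valid-++ _∼_ (standardAt-valid i) (others-valid is)
      whole-valid : Valid _∼_ whole
      whole-valid = valid-++ _∼_ (valid-map (Template X) _∼_ place place-∼ S-valid) (others-valid rest)
      others-weight : ∀ is → weight (concatMap standardAt is) ≡ 6 * length is
      others-weight []       = refl
      others-weight (i ∷ is) = ≡-trans (cong (6 +_) (others-weight is)) (≡-sym (*-suc 6 (length is)))
      whole-weight : weight whole ≡ weight S + 6 * r
      whole-weight = ≡-trans (weight-++ (map (map₁ place) S) others)
                             (cong₂ _+_ (weight-map place S) (others-weight rest))
      standard-covers : ∀ p → p ∈ vertices standard
      standard-covers 0F = here refl
      standard-covers 1F = there (here refl)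
      standard-covers 2F = there (there (here refl))
      standard-covers 3F = there (there (there (here refl)))
      whole-covers : ∀ v → v ∈ vertices whole
      whole-covers v with onto v
      ... | i , p , refl rewrite map-++ vertex (map (map₁ place) S) others
        with ∈-++⁻ (tabulate ix) (∈-resp-↭ split (∈-allFin i))
      ... | inj₁ i∈ with ∈-tabulate⁻ i∈
      ... | a , refl = ∈-++⁺ˡ (subst₂ _∈_
                               (cong (tile (ix a)) (turn-involutive (o a) p)) (≡-sym (vertices-map place S))
                               (∈-map⁺ place (S-covers a (turn (o a) p))))
      whole-covers v | i , p , refl | inj₂ i∈ with ∈-map⁻ vertex (standard-covers p)
      ... | d , d∈ , refl =
        ∈-++⁺ʳ _ (∈-map⁺ vertex (∈-concatMap⁺ standardAt (lose i∈ (∈-map⁺ (map₁ (tile i)) d∈))))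

-- Edges excluded by local exchanges

pick₂ : V → V → Fin 2 → V
pick₂ x y 0F = x
pick₂ x y 1F = y

pick₂-injective : ∀ {x y : V} → x ≢ y → ∀ {a b} → pick₂ x y a ≡ pick₂ x y b → a ≡ b
pick₂-injective x≢y {0F} {0F} e = refl
pick₂-injective x≢y {0F} {1F} e = contradiction e x≢y
pick₂-injective x≢y {1F} {0F} e = contradiction (≡-sym e) x≢y
pick₂-injective x≢y {1F} {1F} e = refl

other : Fin 2 → Fin 2
other 0F = 1F
other 1F = 0F

pick₃ : V → V → V → Fin 3 → V
pick₃ x y z 0F = x
pick₃ x y z 1F = y
pick₃ x y z 2F = z

pick₃-injective : ∀ {x y z : V} → x ≢ y → x ≢ z → y ≢ z →
                  ∀ {a b} → pick₃ x y z a ≡ pick₃ x y z b → a ≡ b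
pick₃-injective xy xz yz {0F} {0F} e = refl
pick₃-injective xy xz yz {0F} {1F} e = contradiction e xy
pick₃-injective xy xz yz {0F} {2F} e = contradiction e xz
pick₃-injective xy xz yz {1F} {0F} e = contradiction (≡-sym e) xy
pick₃-injective xy xz yz {1F} {1F} e = refl
pick₃-injective xy xz yz {1F} {2F} e = contradiction e yz
pick₃-injective xy xz yz {2F} {0F} e = contradiction (≡-sym e) xz
pick₃-injective xy xz yz {2F} {1F} e = contradiction (≡-sym e) yz
pick₃-injective xy xz yz {2F} {2F} e = refl

-- A hub costs 4 and defends all its neighbours in both senses, an idle vertex costs 0 and has to be
-- defended, and a lone vertex costs 2 and needs no neighbour.
hub idle lone : V → Entry V
hub v  = v , full , 2F
idle v = v , ∅ , 0F
lone v = v , (true , false) , 1F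

-- Reversing a tile exchanges a with d and b with c. Up to reversal every end is a and every inner
-- vertex is b, so only three kinds of edges between two tiles have to be considered.
Leaf Inner : Fin 4 → Set
Leaf p  = ∃[ o ] p ≡ turn o 0F
Inner p = ∃[ o ] p ≡ turn o 1F

leaf-or-inner : ∀ p → Leaf p ⊎ Inner p
leaf-or-inner 0F = inj₁ (false , refl)
leaf-or-inner 1F = inj₂ (false , refl)
leaf-or-inner 2F = inj₂ (true , refl)
leaf-or-inner 3F = inj₁ (true , refl)

module Local (G : Graph n) (extremal : 6 * n ≤ 4 * (γr2 G + γR G)) (T : Tiling G k) where
  open Tiling T
  open Rigidity G extremal T

  private
    _∼_ : Fin n → Fin n → Set
    u ∼ v = u ∼[ G ] v

  tile° : Fin k → Bool → Fin 4 → Fin n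
  tile° i o p = tile i (turn o p)

  abstract
    -- With the chord, c is adjacent to the three other vertices, and one hub of cost 4 replaces 6.
    no-chord-ac : ∀ i o → ¬ tile° i o 0F ∼ tile° i o 2F
    no-chord-ac i o e = no-improvement {m = 1} (λ _ → i) (λ { {0F} {0F} _ → refl }) (λ _ → o)
      (((0F , 0F) , (0F , 2F)) ∷ [])
      (idle (0F , 0F) ∷ idle (0F , 1F) ∷ hub (0F , 2F) ∷ idle (0F , 3F) ∷ [])
      _ (e ∷ [])

    -- The tile would contain a 4-cycle. The opposite corners a and c carry different colours and
    -- the Roman values 2 and 1, at cost 5.
    no-chord-ad : ∀ i → ¬ tile i 0F ∼ tile i 3F
    no-chord-ad i e = no-improvement {m = 1} (λ _ → i) (λ { {0F} {0F} _ → refl }) (λ _ → false)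
      (((0F , 0F) , (0F , 3F)) ∷ [])
      (((0F , 0F) , (true , false) , 2F) ∷ idle (0F , 1F) ∷
       ((0F , 2F) , (false , true) , 1F) ∷ idle (0F , 3F) ∷ [])
      _ (e ∷ [])

    module _ {i j : Fin k} (i≢j : i ≢ j) where

      -- The end of tile j sees colour 1 at the end of tile i, so its inner neighbour on j needs
      -- only colour 2. This saves one: 11 instead of 12.
      no-leaf-leaf : ∀ o o′ → ¬ tile° i o 0F ∼ tile° j o′ 0F
      no-leaf-leaf o o′ e = no-improvement {m = 2} (pick₂ i j) (pick₂-injective i≢j) (pick₂ o o′)
        (((0F , 0F) , (1F , 0F)) ∷ [])
        (idle (0F , 3F) ∷ hub (0F , 2F) ∷ idle (0F , 1F) ∷
         lone (0F , 0F) ∷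
         idle (1F , 0F) ∷ ((1F , 1F) , (false , true) , 2F) ∷ idle (1F , 2F) ∷ lone (1F , 3F) ∷ [])
        _ (e ∷ [])

      -- The hub on tile j also defends the end of tile i. A hub next to the opposite end then
      -- suffices for tile i: 10 instead of 12.
      no-leaf-inner : ∀ o o′ → ¬ tile° i o 0F ∼ tile° j o′ 1F
      no-leaf-inner o o′ e = no-improvement {m = 2} (pick₂ i j) (pick₂-injective i≢j) (pick₂ o o′)
        (((0F , 0F) , (1F , 1F)) ∷ [])
        (idle (0F , 3F) ∷ hub (0F , 2F) ∷ idle (0F , 1F) ∷
         idle (0F , 0F) ∷ idle (1F , 0F) ∷ hub (1F , 1F) ∷ idle (1F , 2F) ∷ lone (1F , 3F) ∷ [])
        _ (e ∷ [])

      -- One hub on tile i defends both inner vertices of tile j, whose ends are lone: 6 for tile i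
      -- and 4 for tile j.
      no-inner-both : ∀ o → tile° i o 1F ∼ tile j 1F → ¬ tile° i o 1F ∼ tile j 2F
      no-inner-both o e e′ = no-improvement {m = 2} (pick₂ i j) (pick₂-injective i≢j) (pick₂ o false)
        (((0F , 1F) , (1F , 1F)) ∷ ((0F , 1F) , (1F , 2F)) ∷ [])
        (idle (0F , 0F) ∷ hub (0F , 1F) ∷ idle (0F , 2F) ∷ lone (0F , 3F) ∷
         lone (1F , 0F) ∷ idle (1F , 1F) ∷ idle (1F , 2F) ∷ lone (1F , 3F) ∷ [])
        _ (e ∷ e′ ∷ [])

    -- The edges bᵢbⱼ and cᵢbₗ make cⱼbⱼbᵢcᵢbₗcₗ a path, which the hubs bⱼ and bₗ dominate.
    no-fork : ∀ {i j l} → i ≢ j → i ≢ l → j ≢ l → ∀ o o′ →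
              tile i 1F ∼ tile° j o 1F → ¬ tile i 2F ∼ tile° l o′ 1F
    no-fork {i} {j} {l} i≢j i≢l j≢l o o′ e e′ =
      no-improvement {m = 3} (pick₃ i j l) (pick₃-injective i≢j i≢l j≢l) (pick₃ false o o′)
        (((0F , 1F) , (1F , 1F)) ∷ ((0F , 2F) , (2F , 1F)) ∷ [])
        (lone (0F , 0F) ∷ idle (0F , 1F) ∷ idle (0F , 2F) ∷ lone (0F , 3F) ∷
         idle (1F , 0F) ∷ hub (1F , 1F) ∷ idle (1F , 2F) ∷ lone (1F , 3F) ∷
         idle (2F , 0F) ∷ hub (2F , 1F) ∷ idle (2F , 2F) ∷ lone (2F , 3F) ∷ [])
        _ (e ∷ e′ ∷ [])

    inside : ∀ i p q → tile i p ∼ tile i q → suc (toℕ p) ≡ toℕ q ⊎ suc (toℕ q) ≡ toℕ p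
    inside i 0F 0F e = contradiction e (∼-irrefl G)
    inside i 0F 1F e = inj₁ refl
    inside i 0F 2F e = contradiction e (no-chord-ac i false)
    inside i 0F 3F e = contradiction e (no-chord-ad i)
    inside i 1F 0F e = inj₂ refl
    inside i 1F 1F e = contradiction e (∼-irrefl G)
    inside i 1F 2F e = inj₁ refl
    inside i 1F 3F e = contradiction (∼-sym G e) (no-chord-ac i true)
    inside i 2F 0F e = contradiction (∼-sym G e) (no-chord-ac i false)
    inside i 2F 1F e = inj₂ refl
    inside i 2F 2F e = contradiction e (∼-irrefl G)
    inside i 2F 3F e = inj₁ refl
    inside i 3F 0F e = contradiction (∼-sym G e) (no-chord-ad i)
    inside i 3F 1F e = contradiction e (no-chord-ac i true)
    inside i 3F 2F e = inj₂ refl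
    inside i 3F 3F e = contradiction e (∼-irrefl G)

    between : ∀ {i j p q} → i ≢ j → tile i p ∼ tile j q → Inner p × Inner q
    between {p = p} {q} i≢j e with leaf-or-inner p | leaf-or-inner q
    ... | inj₁ (o , refl) | inj₁ (o′ , refl) = contradiction e (no-leaf-leaf i≢j o o′)
    ... | inj₁ (o , refl) | inj₂ (o′ , refl) = contradiction e (no-leaf-inner i≢j o o′)
    ... | inj₂ (o , refl) | inj₁ (o′ , refl) = contradiction (∼-sym G e) (no-leaf-inner (i≢j ∘ ≡-sym) o′ o)
    ... | inj₂ p-inner    | inj₂ q-inner     = p-inner , q-inner

    share : ∀ {i j} o {q q′} → i ≢ j → tile° i o 1F ∼ tile j q → tile° i o 1F ∼ tile j q′ → q ≡ q′
    share o i≢j e e′ with proj₂ (between i≢j e) | proj₂ (between i≢j e′)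
    ... | false , refl | false , refl = refl
    ... | false , refl | true  , refl = contradiction e′ (no-inner-both i≢j o e)
    ... | true  , refl | false , refl = contradiction e (no-inner-both i≢j o e′)
    ... | true  , refl | true  , refl = refl

    fork : ∀ {i j l q r} → i ≢ j → i ≢ l → tile i 1F ∼ tile j q → tile i 2F ∼ tile l r → j ≡ l
    fork {j = j} {l} i≢j i≢l e e′ with j ≟ l | proj₂ (between i≢j e) | proj₂ (between i≢l e′)
    ... | yes j≡l | _ | _ = j≡l
    ... | no j≢l  | o , refl | o′ , refl = contradiction e′ (no-fork i≢j i≢l j≢l o o′ e)

-- Spanning trees

reach-sym : (G : Graph n) → ∀ {u v} → Reach G u v → Reach G v u
reach-sym G r = go r here
  where
  go : ∀ {u v w} → Reach G u v → Reach G u w → Reach G v w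
  go here       acc = acc
  go (step e r) acc = go r (step (∼-sym G e) acc)

reach-trans : (G : Graph n) → ∀ {u v w} → Reach G u v → Reach G v w → Reach G u w
reach-trans G here       s = s
reach-trans G (step e r) s = step e (reach-trans G r s)

reach-mono : {G H : Graph n} → G ⊆G H → ∀ {u v} → Reach G u v → Reach H u v
reach-mono G⊆H here       = here
reach-mono G⊆H (step e r) = step (G⊆H _ _ e) (reach-mono G⊆H r)

reach-closed : (G : Graph n) (P : Fin n → Set) → (∀ {u v} → u ∼[ G ] v → P u → P v) →
               ∀ {u v} → Reach G u v → P u → P v
reach-closed G P closed here       pu = pu
reach-closed G P closed (step e r) pu = reach-closed G P closed r (closed e pu)

isEdge : Fin k → Fin k → Fin k → Fin k → Bool
isEdge a b i j = does (a ≟ i) ∧ does (b ≟ j)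

isEdge-swap : (a b i j : Fin k) → isEdge a b i j ≡ isEdge b a j i
isEdge-swap a b i j with does (a ≟ i) | does (b ≟ j)
... | true  | true  = refl
... | true  | false = refl
... | false | true  = refl
... | false | false = refl

Σv-isEdge : (a b : Fin k) → Σv (λ i → Σv (λ j → bool→ℕ (isEdge a b i j))) ≡ 1
Σv-isEdge {k} a b = ≡-trans (Σv-cong (λ i → row i)) (Σv-δ a 1)
  where
  indicator : ∀ c → bool→ℕ c ≡ (if c then 1 else 0)
  indicator true  = refl
  indicator false = refl
  row : ∀ i → Σv (λ j → bool→ℕ (isEdge a b i j)) ≡ (if does (a ≟ i) then 1 else 0)
  row i with does (a ≟ i)
  ... | true  = ≡-trans (Σv-cong (λ j → indicator (does (b ≟ j)))) (Σv-δ b 1)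
  ... | false = Σv-zero {k}

module _ (B : Graph k) {x y : Fin k} (x≢y : x ≢ y) where

  addEdge : Graph k
  addEdge = record
    { adj    = λ i j → adj B i j ∨ (isEdge x y i j ∨ isEdge y x i j)
    ; sym    = λ i j → cong₂ _∨_ (Graph.sym B i j)
                 (≡-trans (cong₂ _∨_ (isEdge-swap x y i j) (isEdge-swap y x i j)) (∨-comm (isEdge y x j i) _))
    ; irrefl = λ i → cong₂ _∨_ (irrefl B i) (cong₂ _∨_ (loop i) (≡-trans (isEdge-swap y x i i) (loop i)))
    }
    where
    loop : ∀ i → isEdge x y i i ≡ false
    loop i with x ≟ i | y ≟ i
    ... | yes refl | yes refl = contradiction refl x≢y
    ... | yes _    | no _     = refl
    ... | no _     | yes _    = refl
    ... | no _     | no _     = refl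

  addEdge-⊇ : B ⊆G addEdge
  addEdge-⊇ i j e rewrite e = refl

  addEdge-new : x ∼[ addEdge ] y
  addEdge-new rewrite dec-true (x ≟ x) refl | dec-true (y ≟ y) refl with adj B x y
  ... | true  = refl
  ... | false = refl

  addEdge⁻ : ∀ {i j} → i ∼[ addEdge ] j → i ∼[ B ] j ⊎ (i ≡ x × j ≡ y) ⊎ (i ≡ y × j ≡ x)
  addEdge⁻ {i} {j} e with adj B i j | x ≟ i | y ≟ j | y ≟ i | x ≟ j
  ... | true  | _ | _ | _ | _ = inj₁ refl
  ... | false | yes p | yes q | _ | _ = inj₂ (inj₁ (≡-sym p , ≡-sym q))
  ... | false | _ | _ | yes p | yes q = inj₂ (inj₂ (≡-sym p , ≡-sym q))
  addEdge⁻ () | false | yes _ | no _ | yes _ | no _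
  addEdge⁻ () | false | yes _ | no _ | no _  | _
  addEdge⁻ () | false | no _  | _    | yes _ | no _
  addEdge⁻ () | false | no _  | _    | no _  | _

  degSum-addEdge : adj B x y ≡ false → degSum addEdge ≡ 2 + degSum B
  degSum-addEdge xy = begin
    degSum addEdge
      ≡⟨ Σv-cong (λ i → ≡-trans (Σv-cong (entry i))
           (≡-trans (sum-map-+ (β i) (λ j → ε x y i j + ε y x i j) (allFin k))
                    (cong (Σv (β i) +_) (sum-map-+ (ε x y i) (ε y x i) (allFin k))))) ⟩
    Σv (λ i → Σv (β i) + (Σv (ε x y i) + Σv (ε y x i)))
      ≡⟨ sum-map-+ (λ i → Σv (β i)) (λ i → Σv (ε x y i) + Σv (ε y x i)) (allFin k) ⟩
    degSum B + Σv (λ i → Σv (ε x y i) + Σv (ε y x i))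
      ≡⟨ cong (degSum B +_) (sum-map-+ (λ i → Σv (ε x y i)) (λ i → Σv (ε y x i)) (allFin k)) ⟩
    degSum B + (Σv (λ i → Σv (ε x y i)) + Σv (λ i → Σv (ε y x i)))
      ≡⟨ cong (degSum B +_) (cong₂ _+_ (Σv-isEdge x y) (Σv-isEdge y x)) ⟩
    degSum B + 2
      ≡⟨ +-comm (degSum B) 2 ⟩
    2 + degSum B ∎
    where
    open ≡-Reasoning
    β : Fin k → Fin k → ℕ
    β i j = bool→ℕ (adj B i j)
    ε : Fin k → Fin k → Fin k → Fin k → ℕ
    ε a b i j = bool→ℕ (isEdge a b i j)
    plain : ∀ b → bool→ℕ (b ∨ false) ≡ bool→ℕ b + 0
    plain true  = refl
    plain false = refl
    entry : ∀ i j → bool→ℕ (adj addEdge i j) ≡ β i j + (ε x y i j + ε y x i j)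
    entry i j with x ≟ i | y ≟ j | y ≟ i | x ≟ j
    ... | yes refl | yes refl | yes e | _ = contradiction (≡-sym e) x≢y
    ... | yes refl | yes refl | no _  | _ rewrite xy = refl
    ... | yes p | no _ | yes q | _ = contradiction (≡-trans p (≡-sym q)) x≢y
    ... | no _ | _ | yes refl | yes refl rewrite ≡-trans (Graph.sym B y x) xy = refl
    ... | yes _ | no _ | no _ | _ = plain (adj B i j)
    ... | no _ | _ | yes _ | no _ = plain (adj B i j)
    ... | no _ | _ | no _ | _ = plain (adj B i j)

-- Each added vertex brings one edge and raises the degree sum by 2, starting from 0 at a single
-- vertex; this is the count that `IsTree` demands.
spanning-tree : (C : Graph k) → Connected C → 1 ≤ k → ∃[ B ] IsTree B × B ⊆G C
spanning-tree {suc k} C conn _ = finish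
  (grow C conn TreeOn ext k {K = [ zero ]} (+-comm k 1) (here refl) ([] ∷ []) start)
  where
  -- That edges of `B` stay inside `K` shows that an edge to a vertex outside `K` is new. The bound
  -- `1 ≤ length K` makes the truncated subtraction exact.
  TreeOn : List (Fin (suc k)) → Set
  TreeOn K = 1 ≤ length K × ∃[ B ] B ⊆G C × degSum B ≡ 2 * (length K ∸ 1)
             × (∀ {i j} → i ∼[ B ] j → i ∈ K × j ∈ K) × (∀ {i} → i ∈ K → Reach B zero i)
  start : TreeOn [ zero ]
  start = s≤s z≤n , record { adj = λ _ _ → false ; sym = λ _ _ → refl ; irrefl = λ _ → refl }
        , (λ _ _ ()) , ≡-trans (Σv-cong {suc k} (λ _ → Σv-zero {suc k})) (Σv-zero {suc k})
        , (λ ()) , λ { (here refl) → here }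
  ext : ∀ {K x y} → x ∈ K → y ∉ K → x ∼[ C ] y → TreeOn K → TreeOn (y ∷ K)
  ext {K} {x} {y} x∈ y∉ xy (1≤ , B , B⊆C , deg , inK , reach) =
    s≤s z≤n , addEdge B x≢y , sub , deg′ , inK′ , reach′
    where
    x≢y : x ≢ y
    x≢y refl = y∉ x∈
    no-edge : adj B x y ≡ false
    no-edge with adj B x y in e
    ... | true  = contradiction (proj₂ (inK e)) y∉
    ... | false = refl
    sub : addEdge B x≢y ⊆G C
    sub i j e with addEdge⁻ B x≢y e
    ... | inj₁ e′                   = B⊆C i j e′
    ... | inj₂ (inj₁ (refl , refl)) = xy
    ... | inj₂ (inj₂ (refl , refl)) = ∼-sym C xy
    deg′ : degSum (addEdge B x≢y) ≡ 2 * length K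
    deg′ = ≡-trans (degSum-addEdge B x≢y no-edge)
      (≡-trans (cong (2 +_) deg) (≡-trans (≡-sym (*-suc 2 (length K ∸ 1))) (cong (2 *_) (m+[n∸m]≡n 1≤))))
    inK′ : ∀ {i j} → i ∼[ addEdge B x≢y ] j → i ∈ y ∷ K × j ∈ y ∷ K
    inK′ e with addEdge⁻ B x≢y e
    ... | inj₁ e′                   = there (proj₁ (inK e′)) , there (proj₂ (inK e′))
    ... | inj₂ (inj₁ (refl , refl)) = there x∈ , here refl
    ... | inj₂ (inj₂ (refl , refl)) = here refl , there x∈
    old : ∀ {i} → i ∈ K → Reach (addEdge B x≢y) zero i
    old i∈ = reach-mono {G = B} {addEdge B x≢y} (addEdge-⊇ B x≢y) (reach i∈)
    reach′ : ∀ {i} → i ∈ y ∷ K → Reach (addEdge B x≢y) zero i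
    reach′ (here refl) = reach-trans (addEdge B x≢y) (old x∈) (step (addEdge-new B x≢y) here)
    reach′ (there i∈)  = old i∈
  finish : ∃[ L ] TreeOn L × L ↭ allFin (suc k) → ∃[ B ] IsTree B × B ⊆G C
  finish (L , (_ , B , B⊆C , deg , _ , reach) , p) =
    B , ((λ i j → reach-trans B (reach-sym B (from i)) (from j)) ,
         ≡-trans deg (cong (λ l → 2 * (l ∸ 1)) (≡-trans (↭-length p) (length-allFin {suc k})))) , B⊆C
    where
    from : ∀ i → Reach B zero i
    from i = reach (∈-resp-↭ (↭-sym p) (∈-allFin i))

-- The extremal graphs

module _ (G : Graph n) (conn : Connected G) (extremal : 6 * n ≤ 4 * (γr2 G + γR G)) where

  private
    _∼_ : Fin n → Fin n → Set
    u ∼ v = u ∼[ G ] v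

  turned : Tiling G k → (Fin k → Bool) → Tiling G k
  turned T o = record
    { tile = λ i p → tile i (turn (o i) p)
    ; path = λ i → tile-∼ (o i) i 0F 1F refl , tile-∼ (o i) i 1F 2F refl , tile-∼ (o i) i 2F 3F refl
    ; onto = λ v → let i , p , e = onto v in
                   i , turn (o i) p , ≡-trans (cong (tile i) (turn-involutive (o i) p)) e
    ; size = size
    }
    where open Tiling T

  module _ (T : Tiling G k) where
    open Tiling T
    open Local G extremal T

    pathEdge⇒∼ : ∀ {i j p q} → PathEdge (i , p) (j , q) → tile i p ∼ tile j q
    pathEdge⇒∼ {i} {p = p} {q} (refl , inj₁ e) = tile-∼ false i p q e
    pathEdge⇒∼ {i} {p = p} {q} (refl , inj₂ e) = ∼-sym G (tile-∼ false i q p e)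

    -- Edges between tiles join inner vertices, and `free` forbids the c's, so they all join b's.
    class-Tₖ : 1 ≤ k → (∀ {i j q} → i ≢ j → ¬ tile i 2F ∼ tile j q) → FromTkPlusB G
    class-Tₖ 1≤k free = let B , B-tree , B⊆C = spanning-tree C C-connected 1≤k in
      k , 1≤k , B , C , B-tree , B⊆C , φ , λ x y → mk⇔ (to x y) (from x y)
      where
      C : Graph k
      C = record { adj = λ i j → adj G (tile i 1F) (tile j 1F)
                 ; sym = λ i j → Graph.sym G _ _ ; irrefl = λ i → irrefl G _ }
      only-b : ∀ {i j p q} → i ≢ j → tile i p ∼ tile j q → p ≡ 1F
      only-b i≢j e with proj₁ (between i≢j e)
      ... | false , refl = refl
      ... | true  , refl = contradiction e (free i≢j)
      -- A walk in `G` projects to a walk in `C`: steps within a tile are dropped, and every other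
      -- step joins two b's.
      reach-tiles : ∀ {u v} → Reach G u v → ∀ {i j p q} → tile i p ≡ u → tile j q ≡ v → Reach C i j
      reach-tiles here refl e with tile-injective e
      ... | refl , _ = here
      reach-tiles (step {v = w} uw r) {i} {p = p} refl e with onto w
      ... | l , s , refl with i ≟ l
      ... | yes refl = reach-tiles r refl e
      ... | no i≢l with only-b {p = p} i≢l uw | only-b {p = s} (i≢l ∘ ≡-sym) (∼-sym G uw)
      ... | refl | refl = step uw (reach-tiles r refl e)
      C-connected : Connected C
      C-connected i j = reach-tiles (conn (tile i 1F) (tile j 1F)) refl refl
      φ : (Fin k × Fin 4) ⤖ Fin n
      φ = mk⤖ {to = uncurry tile}
        ((λ e → let i≡j , p≡q = tile-injective e in cong₂ _,_ i≡j p≡q) ,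
         λ v → let i , p , e = onto v in (i , p) , λ { refl → e })
      Adjacent : Fin k × Fin 4 → Fin k × Fin 4 → Set
      Adjacent x y = PathEdge x y ⊎ (toℕ (proj₂ x) ≡ 1 × toℕ (proj₂ y) ≡ 1 × proj₁ x ∼[ C ] proj₁ y)
      to : ∀ x y → uncurry tile x ∼ uncurry tile y → Adjacent x y
      to (i , p) (j , q) e with i ≟ j
      ... | yes refl = inj₁ (refl , inside i p q e)
      ... | no i≢j with only-b {p = p} i≢j e | only-b {p = q} (i≢j ∘ ≡-sym) (∼-sym G e)
      ... | refl | refl = inj₂ (refl , refl , e)
      from : ∀ x y → Adjacent x y → uncurry tile x ∼ uncurry tile y
      from x y (inj₁ e) = pathEdge⇒∼ e
      from (i , p) (j , q) (inj₂ (p≡1 , q≡1 , e))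
        with toℕ-injective {i = p} {j = 1F} p≡1 | toℕ-injective {i = q} {j = 1F} q≡1
      ... | refl | refl = e

    module _ {i j : Fin k} (i≢j : i ≢ j) (bb : tile i 1F ∼ tile j 1F) (cc : tile i 2F ∼ tile j 2F) where

      private
        ix : Fin 2 → Fin k
        ix = pick₂ i j

        ix-≢ : ∀ {α β} → α ≢ β → ix α ≢ ix β
        ix-≢ α≢β = α≢β ∘ pick₂-injective i≢j

        rung : ∀ {α β} → α ≢ β → ∀ o → tile° (ix α) o 1F ∼ tile° (ix β) o 1F
        rung {0F} {0F} α≢β _     = contradiction refl α≢β
        rung {0F} {1F} _   false = bb
        rung {0F} {1F} _   true  = cc
        rung {1F} {0F} _   false = ∼-sym G bb
        rung {1F} {0F} _   true  = ∼-sym G cc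
        rung {1F} {1F} α≢β _     = contradiction refl α≢β

        other-≢ : ∀ α → α ≢ other α
        other-≢ 0F ()
        other-≢ 1F ()

        -- `fork` compares an edge leaving at b with the rung at c, and one leaving at c with the
        -- rung at b; either way it must lead to the other of the two tiles.
        confined : ∀ α {l p q} → ix α ≢ l → tile (ix α) p ∼ tile l q → l ≡ ix (other α)
        confined α α≢l e with proj₁ (between α≢l e)
        ... | false , refl = fork α≢l (ix-≢ (other-≢ α)) e (rung (other-≢ α) true)
        ... | true  , refl = ≡-sym (fork (ix-≢ (other-≢ α)) α≢l (rung (other-≢ α) false) e)

        Covered : Fin n → Set
        Covered v = ∃[ α ] ∃[ p ] tile (ix α) p ≡ v

        -- By `confined` the two tiles are closed under adjacency, so connectedness makes them the
        -- whole graph.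
        all-covered : ∀ v → Covered v
        all-covered v = reach-closed G Covered closed (conn (tile i 0F) v) (0F , 0F , refl)
          where
          closed : ∀ {u v} → u ∼ v → Covered u → Covered v
          closed {v = v} e (α , p , refl) with onto v
          ... | l , q , refl with ix α ≟ l
          ... | yes refl = α , q , refl
          ... | no α≢l   = other α , q , cong (λ a → tile a q) (≡-sym (confined α α≢l e))

      class-T₂ : FromT2PlusC G
      class-T₂ = φ , λ x y → mk⇔ (to x y) (from x y)
        where
        f : Fin 2 × Fin 4 → Fin n
        f (α , p) = tile (ix α) p
        φ : (Fin 2 × Fin 4) ⤖ Fin n
        φ = mk⤖ {to = f}
          ((λ e → let α≡β , p≡q = tile-injective e in cong₂ _,_ (pick₂-injective i≢j α≡β) p≡q) ,
           λ v → let α , p , e = all-covered v in (α , p) , λ { refl → e })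
        Adjacent : Fin 2 × Fin 4 → Fin 2 × Fin 4 → Set
        Adjacent x y = PathEdge x y
          ⊎ (¬ proj₁ x ≡ proj₁ y × toℕ (proj₂ x) ≡ 1 × toℕ (proj₂ y) ≡ 1)
          ⊎ (¬ proj₁ x ≡ proj₁ y × toℕ (proj₂ x) ≡ 2 × toℕ (proj₂ y) ≡ 2)
        to : ∀ x y → f x ∼ f y → Adjacent x y
        to (α , p) (β , q) e with α ≟ β
        ... | yes refl = inj₁ (refl , inside (ix α) p q e)
        ... | no α≢β with proj₁ (between (ix-≢ α≢β) e)
        ... | o , refl with o | share o (ix-≢ α≢β) e (rung α≢β o)
        ... | false | refl = inj₂ (inj₁ (α≢β , refl , refl))
        ... | true  | refl = inj₂ (inj₂ (α≢β , refl , refl))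
        from : ∀ x y → Adjacent x y → f x ∼ f y
        from (α , p) (β , q) (inj₁ (refl , e)) = pathEdge⇒∼ (refl , e)
        from (α , p) (β , q) (inj₂ (inj₁ (α≢β , p≡1 , q≡1)))
          with toℕ-injective {i = p} {j = 1F} p≡1 | toℕ-injective {i = q} {j = 1F} q≡1
        ... | refl | refl = rung α≢β false
        from (α , p) (β , q) (inj₂ (inj₂ (α≢β , p≡2 , q≡2)))
          with toℕ-injective {i = p} {j = 2F} p≡2 | toℕ-injective {i = q} {j = 2F} q≡2
        ... | refl | refl = rung α≢β true

  module _ (T : Tiling G k) where
    open Tiling T
    open Local G extremal T

    Active : Fin k → Bool → Set
    Active i o = ∃[ j ] i ≢ j × ∃[ q ] tile° i o 1F ∼ tile j q

    active? : ∀ i o → Dec (Active i o)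
    active? i o = any? λ j → ¬? (i ≟ j) ×-dec any? λ q → adj G (tile° i o 1F) (tile j q) Bool.≟ true

    -- If no tile has outside neighbours at both inner vertices, reversing tiles moves all of them
    -- to the b's. Otherwise `fork` sends both edges of such a tile to the same tile `j`, and a
    -- suitable orientation of `j` turns them into the rungs bb and cc.
    classify : 1 ≤ k → InClassG G
    classify 1≤k with any? (λ i → active? i false ×-dec active? i true)
    ... | no ¬both = inj₂ (class-Tₖ (turned T o) 1≤k (λ {i} i≢j e → inactive i (_ , i≢j , _ , e)))
      where
      -- Tile `i` is reversed exactly if its c has an outside neighbour; its new c is then the old
      -- b, which has none.
      o : Fin k → Bool
      o i = does (active? i true)
      inactive : ∀ i → ¬ (∃[ j ] i ≢ j × ∃[ q ] tile i (turn (o i) 2F) ∼ tile j (turn (o j) q))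
      inactive i (j , i≢j , q , e) with active? i true
      ... | yes act = ¬both (i , (j , i≢j , _ , e) , act)
      ... | no ¬act = ¬act (j , i≢j , _ , e)
    ... | yes (i , (j , i≢j , q , b∼) , (l , i≢l , r , c∼)) with fork i≢j i≢l b∼ c∼
    ... | refl with proj₂ (between i≢j b∼) | proj₂ (between i≢j c∼)
    ... | o , refl | o′ , refl = inj₁ (class-T₂ (turned T s) i≢j bb cc)
      where
      -- Only tile `j` is reversed, and only if the b of tile `i` meets the c of tile `j`.
      s : Fin k → Bool
      s l = does (l ≟ j) ∧ o
      s-i : s i ≡ false
      s-i rewrite dec-false (i ≟ j) i≢j = refl
      s-j : s j ≡ o
      s-j rewrite dec-true (j ≟ j) refl = refl
      bb : tile i (turn (s i) 1F) ∼ tile j (turn (s j) 1F)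
      bb rewrite s-i | s-j = b∼
      -- A common neighbour on tile `j` of both inner vertices of tile `i` would itself have two
      -- neighbours on tile `i`, against `share`.
      opposed : ∀ o o′ → tile i 1F ∼ tile° j o 1F → tile i 2F ∼ tile° j o′ 1F → turn o′ 1F ≡ turn o 2F
      opposed false false e e′ with share false (i≢j ∘ ≡-sym) (∼-sym G e) (∼-sym G e′)
      ... | ()
      opposed false true  e e′ = refl
      opposed true  false e e′ = refl
      opposed true  true  e e′ with share true (i≢j ∘ ≡-sym) (∼-sym G e) (∼-sym G e′)
      ... | ()
      cc : tile i (turn (s i) 2F) ∼ tile j (turn (s j) 2F)
      cc rewrite s-i | s-j = subst (λ p → tile i 2F ∼ tile j p) (opposed o o′ b∼ c∼) c∼

-- The lower bound for the class 𝒢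

-- What both kinds of domination functions have in common at a vertex x with a pendant neighbour x′.
Coronal : Graph n → (Fin n → ℕ) → Set
Coronal G w = ∀ {x x′} → x ∼[ G ] x′ → (∀ {z} → x′ ∼[ G ] z → z ≡ x) →
              2 ≤ w x + w x′ ⊎ (w x ≡ 0 × w x′ ≡ 1 × ∃[ y ] x ∼[ G ] y × y ≢ x′ × 1 ≤ w y)

card12-pos₁ : ∀ s → proj₁ s ≡ true → 1 ≤ card12 s
card12-pos₁ (true , _) _ = s≤s z≤n

card12-pos₂ : ∀ s → proj₂ s ≡ true → 1 ≤ card12 s
card12-pos₂ (true  , true) _ = s≤s z≤n
card12-pos₂ (false , true) _ = s≤s z≤n

-- If x′ is empty, its only neighbour x carries both colours. If x is empty and x′ has one colour,
-- the missing colour comes from a neighbour of x other than x′. In the remaining cases the two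
-- weights add up to at least 2.
rainbow-coronal : (G : Graph n) (f : Fin n → Sub12) → Rainbow G f → Coronal G (card12 ∘ f)
rainbow-coronal G f R {x} {x′} xx′ pendant with f x in fx | f x′ in fx′
... | _ | false , false with R x′ fx′
... | (v , x′v , fv) , (u , x′u , fu) with pendant x′v | pendant x′u
... | refl | refl with ≡-trans (≡-sym fx) (cong₂ _,_ fv fu)
... | refl = inj₁ ≤-refl
rainbow-coronal G f R xx′ pendant | s | true , true = inj₁ (m≤n+m 2 (card12 s))
rainbow-coronal G f R xx′ pendant | true , b | true , false = inj₁ (s≤s (m≤n+m 1 (bool→ℕ b)))
rainbow-coronal G f R xx′ pendant | true , b | false , true = inj₁ (s≤s (m≤n+m 1 (bool→ℕ b)))
rainbow-coronal G f R xx′ pendant | false , true | true , false = inj₁ ≤-refl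
rainbow-coronal G f R xx′ pendant | false , true | false , true = inj₁ ≤-refl
rainbow-coronal G f R {x} xx′ pendant | false , false | true , false with proj₂ (R x fx)
... | v , xv , fv = inj₂ (refl , refl , v , xv ,
  (λ { refl → contradiction (≡-trans (≡-sym fv) (cong proj₂ fx′)) λ () }) , card12-pos₂ (f v) fv)
rainbow-coronal G f R {x} xx′ pendant | false , false | false , true with proj₁ (R x fx)
... | v , xv , fv = inj₂ (refl , refl , v , xv ,
  (λ { refl → contradiction (≡-trans (≡-sym fv) (cong proj₁ fx′)) λ () }) , card12-pos₁ (f v) fv)

-- The same alternatives, where the value 2 that x needs cannot come from x′ when x′ has value 1.
roman-coronal : (G : Graph n) (g : Fin n → Fin 3) → Roman G g → Coronal G (toℕ ∘ g)
roman-coronal G g R {x} {x′} xx′ pendant with g x in gx | g x′ in gx′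
... | _ | 0F with R x′ gx′
... | v , x′v , gv with pendant x′v
... | refl with ≡-trans (≡-sym gx) gv
... | refl = inj₁ ≤-refl
roman-coronal G g R xx′ pendant | s | 2F = inj₁ (m≤n+m 2 (toℕ s))
roman-coronal G g R xx′ pendant | suc s | 1F = inj₁ (s≤s (m≤n+m 1 (toℕ s)))
roman-coronal G g R {x} xx′ pendant | 0F | 1F with R x gx
... | v , xv , gv = inj₂ (refl , refl , v , xv ,
  (λ { refl → contradiction (≡-trans (≡-sym gv) gx′) λ () }) ,
                          subst (λ t → 1 ≤ toℕ t) (≡-sym gv) (s≤s z≤n))

coronal⇒γ-sum-≥ : (G : Graph n) → m ≤ n → (∀ w → Coronal G w → m ≤ Σv w) → m + m ≤ γr2 G + γR G
coronal⇒γ-sum-≥ G m≤n bound = +-mono-≤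
  (γr2-≥ G m≤n (λ f R → bound _ (rainbow-coronal G f R)))
  (γR-≥ G m≤n (λ g R → bound _ (roman-coronal G g R)))

positions : ∀ k → List (Fin k × Fin 4)
positions k = cartesianProduct (allFin k) (allFin 4)

length-blocks : (is : List V) → length (cartesianProduct is (allFin 4)) ≡ length is * 4
length-blocks []       = refl
length-blocks (_ ∷ is) = cong (4 +_) (length-blocks is)

module _ (φ : (Fin k × Fin 4) ⤖ Fin n) where
  open Bijection φ using (injective; strictlySurjective) renaming (to to place)

  place-positions : map place (positions k) ↭ allFin n
  place-positions = ∼bag⇒↭ (unique∧set⇒bag
    (unique-map⁺ injective (cartesianProduct⁺ (allFin⁺ k) (allFin⁺ 4))) (allFin⁺ n)
    (λ {v} → mk⇔ (λ _ → ∈-allFin v)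
         (λ _ → let (i , p) , e = strictlySurjective v in
                subst (_∈ map place (positions k)) e (∈-map⁺ place (∈-cartesianProduct⁺ (∈-allFin i) (∈-allFin p))))))

  order≡k*4 : n ≡ k * 4
  order≡k*4 = begin
    n                                 ≡⟨ length-allFin ⟨
    length (allFin n)                 ≡⟨ ↭-length place-positions ⟨
    length (map place (positions k))  ≡⟨ length-map place (positions k) ⟩
    length (positions k)              ≡⟨ length-blocks (allFin k) ⟩
    length (allFin k) * 4             ≡⟨ cong (_* 4) (length-allFin {k}) ⟩
    k * 4                             ∎
    where open ≡-Reasoning

  Σv-positions : ∀ w → Σv w ≡ sum (map (w ∘ place) (positions k))
  Σv-positions w = ≡-trans (≡-sym (sum-↭ (↭-map⁺ w place-positions))) (cong sum (≡-sym (map-∘ (positions k))))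

sum-blocks : (u : V × Fin 4 → ℕ) → (∀ i → m ≤ u (i , 0F) + (u (i , 1F) + (u (i , 2F) + u (i , 3F)))) →
             ∀ is → length is * m ≤ sum (map u (cartesianProduct is (allFin 4)))
sum-blocks u bound []       = z≤n
sum-blocks {m = m} u bound (i ∷ is) = ≤-trans (+-mono-≤ (bound i) (sum-blocks u bound is))
  (≤-reflexive (assoc (u (i , 0F)) (u (i , 1F)) (u (i , 2F)) (u (i , 3F)) _))
  where
  assoc : ∀ a b c d r → a + (b + (c + d)) + r ≡ a + (b + (c + (d + r)))
  assoc = solve-∀

leaf-next : ∀ o q → Next (turn o 0F) q → q ≡ turn o 1F
leaf-next false = from-yes (all? λ q → next? 0F q →-dec (q ≟ 1F))
leaf-next true  = from-yes (all? λ q → next? 3F q →-dec (q ≟ 2F))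

inner-next : ∀ o q → Next (turn o 1F) q → q ≡ turn o 0F ⊎ q ≡ turn (not o) 1F
inner-next false = from-yes (all? λ q → next? 1F q →-dec ((q ≟ 0F) ⊎-dec (q ≟ 2F)))
inner-next true  = from-yes (all? λ q → next? 2F q →-dec ((q ≟ 3F) ⊎-dec (q ≟ 1F)))

next-inner : ∀ o → Next (turn o 1F) (turn o 0F)
next-inner false = inj₂ refl
next-inner true  = inj₁ refl

leaf≢b : ∀ o → toℕ (turn o 0F) ≢ 1
leaf≢b false ()
leaf≢b true  ()

leaf≢c : ∀ o → toℕ (turn o 0F) ≢ 2
leaf≢c false ()
leaf≢c true  ()

-- Each of the pairs a, b and c, d of a tile weighs at least 1. If neither reached 2, then b and c
-- would be 0; but c has no neighbours besides b and d, so b would have to be positive. Hence every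
-- tile weighs at least 3.
class-Tₖ-bound : (G : Graph n) → FromTkPlusB G → 6 * n ≤ 4 * (γr2 G + γR G)
class-Tₖ-bound {n} G (k , _ , B , C , _ , _ , φ , spec) = begin
  6 * n                        ≡⟨ cong (6 *_) (order≡k*4 φ) ⟩
  6 * (k * 4)                  ≡⟨ arith k ⟩
  4 * (k * 3 + k * 3)          ≤⟨ *-monoʳ-≤ 4 (coronal⇒γ-sum-≥ G 3k≤n bound) ⟩
  4 * (γr2 G + γR G)           ∎
  where
  open ≤-Reasoning
  open Bijection φ using (strictlySurjective) renaming (to to place)
  arith : ∀ k → 6 * (k * 4) ≡ 4 * (k * 3 + k * 3)
  arith = solve-∀
  3k≤n : k * 3 ≤ n
  3k≤n = subst (k * 3 ≤_) (≡-sym (order≡k*4 φ)) (*-monoʳ-≤ k (n≤1+n 3))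
  neighbour : ∀ {i p z} → toℕ p ≢ 1 → place (i , p) ∼[ G ] z → ∃[ q ] Next p q × z ≡ place (i , q)
  neighbour {i} {p} {z} p≢b e with strictlySurjective z
  ... | (j , q) , refl with Equivalence.to (spec (i , p) (j , q)) e
  ... | inj₁ (refl , c)    = q , c , refl
  ... | inj₂ (p≡b , _ , _) = contradiction p≡b p≢b
  module _ (w : Fin n → ℕ) (cor : Coronal G w) (i : Fin k) where
    a b c d : ℕ
    a = w (place (i , 0F))
    b = w (place (i , 1F))
    c = w (place (i , 2F))
    d = w (place (i , 3F))
    pendant : ∀ o {z} → place (i , turn o 0F) ∼[ G ] z → z ≡ place (i , turn o 1F)
    pendant o e with neighbour (leaf≢b o) e
    ... | q , next , refl rewrite leaf-next o q next = refl
    at : ∀ o → _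
    at o = cor (Equivalence.from (spec (i , turn o 1F) (i , turn o 0F)) (inj₁ (refl , next-inner o)))
               (pendant o)
    c-neighbour : ∀ {z} → place (i , 2F) ∼[ G ] z → z ≢ place (i , 3F) → z ≡ place (i , 1F)
    c-neighbour e z≢d with neighbour (λ ()) e
    ... | q , next , refl with inner-next true q next
    ... | inj₁ refl = contradiction refl z≢d
    ... | inj₂ refl = refl
    block : 3 ≤ a + (b + (c + d))
    block with at false | at true
    ... | inj₁ ba | inj₁ cd =
      ≤-trans (n≤1+n 3) (≤-trans (+-mono-≤ ba cd) (≤-reflexive (assoc a b c d)))
      where
      assoc : ∀ a b c d → b + a + (c + d) ≡ a + (b + (c + d))
      assoc = solve-∀
    ... | inj₁ ba | inj₂ (_ , d≡1 , _) =
      ≤-trans (+-mono-≤ ba (≤-reflexive (≡-sym d≡1))) (≤-trans (m≤m+n _ c) (≤-reflexive (assoc a b c d)))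
      where
      assoc : ∀ a b c d → b + a + d + c ≡ a + (b + (c + d))
      assoc = solve-∀
    ... | inj₂ (_ , a≡1 , _) | inj₁ cd = +-mono-≤ (≤-reflexive (≡-sym a≡1)) (≤-trans cd (m≤n+m _ b))
    ... | inj₂ (b≡0 , _ , _) | inj₂ (_ , _ , y , cy , y≢d , wy) with c-neighbour cy y≢d
    ... | refl = contradiction (≤-trans wy (≤-reflexive b≡0)) 1+n≰n
  bound : ∀ w → Coronal G w → k * 3 ≤ Σv w
  bound w cor = begin
    k * 3                                  ≡⟨ cong (_* 3) (length-allFin {k}) ⟨
    length (allFin k) * 3                  ≤⟨ sum-blocks (w ∘ place) (block w cor) (allFin k) ⟩
    sum (map (w ∘ place) (positions k))    ≡⟨ Σv-positions φ w ⟨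
    Σv w                                   ∎

positive : ∀ {s} {P : Set} → 2 ≤ s ⊎ s ≡ 1 × P → 1 ≤ s
positive (inj₁ h)          = ≤-trans (n≤1+n 1) h
positive (inj₂ (refl , _)) = ≤-refl

-- The pairs of weight at least 2 dominate the 4-cycle of all pairs, so there are two of them.
cycle-sum : ∀ {s₀ s₁ s₂ s₃} →
  2 ≤ s₀ ⊎ s₀ ≡ 1 × (2 ≤ s₁ ⊎ 2 ≤ s₃) → 2 ≤ s₁ ⊎ s₁ ≡ 1 × (2 ≤ s₀ ⊎ 2 ≤ s₂) →
  2 ≤ s₂ ⊎ s₂ ≡ 1 × (2 ≤ s₃ ⊎ 2 ≤ s₁) → 2 ≤ s₃ ⊎ s₃ ≡ 1 × (2 ≤ s₂ ⊎ 2 ≤ s₀) →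
  6 ≤ s₀ + s₁ + (s₂ + s₃)
cycle-sum c₀ c₁ c₂ c₃ with positive c₀ | positive c₁ | positive c₂ | positive c₃
cycle-sum (inj₁ h₀) (inj₁ h₁) _ _ | _ | _ | p₂ | p₃ = +-mono-≤ (+-mono-≤ h₀ h₁) (+-mono-≤ p₂ p₃)
cycle-sum (inj₁ h₀) _ (inj₁ h₂) _ | _ | p₁ | _ | p₃ = +-mono-≤ (+-mono-≤ h₀ p₁) (+-mono-≤ h₂ p₃)
cycle-sum (inj₁ h₀) _ _ (inj₁ h₃) | _ | p₁ | p₂ | _ = +-mono-≤ (+-mono-≤ h₀ p₁) (+-mono-≤ p₂ h₃)
cycle-sum _ (inj₁ h₁) (inj₁ h₂) _ | p₀ | _ | _ | p₃ = +-mono-≤ (+-mono-≤ p₀ h₁) (+-mono-≤ h₂ p₃)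
cycle-sum _ (inj₁ h₁) _ (inj₁ h₃) | p₀ | _ | p₂ | _ = +-mono-≤ (+-mono-≤ p₀ h₁) (+-mono-≤ p₂ h₃)
cycle-sum _ _ (inj₁ h₂) (inj₁ h₃) | p₀ | p₁ | _ | _ = +-mono-≤ (+-mono-≤ p₀ p₁) (+-mono-≤ h₂ h₃)
-- Otherwise at least three pairs have weight 1. They are consecutive on the cycle, and the middle
-- one has no neighbour of weight at least 2.
cycle-sum _ (inj₂ (refl , _)) (inj₂ (refl , inj₁ h)) (inj₂ (refl , _)) | _ | _ | _ | _ =
  contradiction h 1+n≰n
cycle-sum _ (inj₂ (refl , _)) (inj₂ (refl , inj₂ h)) (inj₂ (refl , _)) | _ | _ | _ | _ =
  contradiction h 1+n≰n
cycle-sum (inj₂ (refl , _)) _ (inj₂ (refl , _)) (inj₂ (refl , inj₁ h)) | _ | _ | _ | _ =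
  contradiction h 1+n≰n
cycle-sum (inj₂ (refl , _)) _ (inj₂ (refl , _)) (inj₂ (refl , inj₂ h)) | _ | _ | _ | _ =
  contradiction h 1+n≰n
cycle-sum (inj₂ (refl , inj₁ h)) (inj₂ (refl , _)) _ (inj₂ (refl , _)) | _ | _ | _ | _ =
  contradiction h 1+n≰n
cycle-sum (inj₂ (refl , inj₂ h)) (inj₂ (refl , _)) _ (inj₂ (refl , _)) | _ | _ | _ | _ =
  contradiction h 1+n≰n
cycle-sum (inj₂ (refl , _)) (inj₂ (refl , inj₁ h)) (inj₂ (refl , _)) _ | _ | _ | _ | _ =
  contradiction h 1+n≰n
cycle-sum (inj₂ (refl , _)) (inj₂ (refl , inj₂ h)) (inj₂ (refl , _)) _ | _ | _ | _ | _ =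
  contradiction h 1+n≰n

≢⇒other : ∀ α β → α ≢ β → β ≡ other α
≢⇒other 0F 0F α≢β = contradiction refl α≢β
≢⇒other 0F 1F _   = refl
≢⇒other 1F 0F _   = refl
≢⇒other 1F 1F α≢β = contradiction refl α≢β

-- A tile may weigh only 2, so the bound is taken over both. The inner vertices form the 4-cycle
-- b₁c₁c₂b₂, each with its own pendant neighbour. A pair of weight below 2 has inner value 0 and
-- hence a positive inner neighbour on the cycle; the pair of that neighbour weighs at least 2,
-- since its inner value is not 0.
class-T₂-bound : (G : Graph n) → FromT2PlusC G → 6 * n ≤ 4 * (γr2 G + γR G)
class-T₂-bound {n} G (φ , spec) = begin
  6 * n                        ≡⟨ cong (6 *_) (order≡k*4 φ) ⟩
  4 * (6 + 6)                  ≤⟨ *-monoʳ-≤ 4 (coronal⇒γ-sum-≥ G 6≤n bound) ⟩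
  4 * (γr2 G + γR G)           ∎
  where
  open ≤-Reasoning
  open Bijection φ using (strictlySurjective) renaming (to to place)
  6≤n : 6 ≤ n
  6≤n = subst (6 ≤_) (≡-sym (order≡k*4 φ)) (m≤m+n 6 2)
  pendant : ∀ α o {z} → place (α , turn o 0F) ∼[ G ] z → z ≡ place (α , turn o 1F)
  pendant α o {z} e with strictlySurjective z
  ... | (β , q) , refl with Equivalence.to (spec (α , turn o 0F) (β , q)) e
  ... | inj₁ (refl , next)          = cong (λ q → place (α , q)) (leaf-next o q next)
  ... | inj₂ (inj₁ (_ , p≡b , _))   = contradiction p≡b (leaf≢b o)
  ... | inj₂ (inj₂ (_ , p≡c , _))   = contradiction p≡c (leaf≢c o)
  inner-neighbour : ∀ α o {z} → place (α , turn o 1F) ∼[ G ] z → z ≢ place (α , turn o 0F) →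
                    z ≡ place (α , turn (not o) 1F) ⊎ z ≡ place (other α , turn o 1F)
  inner-neighbour α o {z} e z≢leaf with strictlySurjective z
  ... | (β , q) , refl with Equivalence.to (spec (α , turn o 1F) (β , q)) e
  ... | inj₂ (inj₁ (α≢β , p≡b , q≡b)) rewrite ≢⇒other α β α≢β =
    inj₂ (cong (λ q → place (other α , q)) (toℕ-injective (≡-trans q≡b (≡-sym p≡b))))
  ... | inj₂ (inj₂ (α≢β , p≡c , q≡c)) rewrite ≢⇒other α β α≢β =
    inj₂ (cong (λ q → place (other α , q)) (toℕ-injective (≡-trans q≡c (≡-sym p≡c))))
  ... | inj₁ (refl , next) with inner-next o q next
  ... | inj₁ refl = contradiction refl z≢leaf
  ... | inj₂ refl = inj₁ refl
  module _ (w : Fin n → ℕ) (cor : Coronal G w) where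
    s : Fin 2 → Bool → ℕ
    s α o = w (place (α , turn o 1F)) + w (place (α , turn o 0F))
    at : ∀ α o → _
    at α o = cor (Equivalence.from (spec (α , turn o 1F) (α , turn o 0F)) (inj₁ (refl , next-inner o)))
                 (pendant α o)
    heavy : ∀ α o → 1 ≤ w (place (α , turn o 1F)) → 2 ≤ s α o
    heavy α o pos with at α o
    ... | inj₁ h             = h
    ... | inj₂ (x≡0 , _ , _) = contradiction (≤-trans pos (≤-reflexive x≡0)) 1+n≰n
    around : ∀ α o → 2 ≤ s α o ⊎ s α o ≡ 1 × (2 ≤ s α (not o) ⊎ 2 ≤ s (other α) o)
    around α o with at α o
    ... | inj₁ h = inj₁ h
    ... | inj₂ (x≡0 , x′≡1 , y , xy , y≢x′ , wy) with inner-neighbour α o xy y≢x′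
    ... | inj₁ refl = inj₂ (cong₂ _+_ x≡0 x′≡1 , inj₁ (heavy α (not o) wy))
    ... | inj₂ refl = inj₂ (cong₂ _+_ x≡0 x′≡1 , inj₂ (heavy (other α) o wy))
  bound : ∀ w → Coronal G w → 6 ≤ Σv w
  bound w cor = begin
    6
      ≤⟨ cycle-sum (t 0F false) (t 0F true) (t 1F true) (t 1F false) ⟩
    s w cor 0F false + s w cor 0F true + (s w cor 1F true + s w cor 1F false)
      ≡⟨ assoc (v 0F 0F) (v 0F 1F) (v 0F 2F) (v 0F 3F) (v 1F 0F) (v 1F 1F) (v 1F 2F) (v 1F 3F) ⟩
    sum (map (w ∘ place) (positions 2))               ≡⟨ Σv-positions φ w ⟨
    Σv w                                              ∎
    where
    t = around w cor
    v : Fin 2 → Fin 4 → ℕ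
    v α p = w (place (α , p))
    assoc : ∀ a b c d a′ b′ c′ d′ → b + a + (c + d) + (c′ + d′ + (b′ + a′)) ≡
            a + (b + (c + (d + (a′ + (b′ + (c′ + (d′ + 0)))))))
    assoc = solve-∀

theorem10 : ∀ {n : ℕ} (G : Graph n) → 3 ≤ n → Connected G →
    (4 * (γr2 G + γR G) ≤ 6 * n)
    × ((4 * (γr2 G + γR G) ≡ 6 * n) ⇔ InClassG G)
theorem10 {n} G 3≤n conn with economical-allFin G conn 3≤n
-- One certificate serves both halves: its strict case is incompatible with equality, and its other
-- case supplies the tiling.
... | S , valid , covers , cost = upper cost , mk⇔ (equality cost) (≤-antisym (upper cost) ∘ lower)
  where
  γ≤weight : 4 * (γr2 G + γR G) ≤ 4 * weight S
  γ≤weight = *-monoʳ-≤ 4 (γ-sum-≤ G S valid (λ v → covers (∈-allFin v)))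
  6|V|≡6n : 6 * length (allFin n) ≡ 6 * n
  6|V|≡6n = cong (6 *_) (length-allFin {n})
  Cost : Set
  Cost = 4 * weight S < 6 * length (allFin n)
         ⊎ 4 * weight S ≡ 6 * length (allFin n) × ∃ (PathCover G (allFin n))
  upper : Cost → 4 * (γr2 G + γR G) ≤ 6 * n
  upper (inj₁ lt)       = ≤-trans γ≤weight (≤-trans (<⇒≤ lt) (≤-reflexive 6|V|≡6n))
  upper (inj₂ (eq , _)) = ≤-trans γ≤weight (≤-reflexive (≡-trans eq 6|V|≡6n))
  nonempty : ∀ {k} → n ≡ k * 4 → 1 ≤ k
  nonempty {zero}  n≡0 = contradiction (≤-trans 3≤n (≤-reflexive n≡0)) λ ()
  nonempty {suc _} _   = s≤s z≤n
  equality : Cost → 4 * (γr2 G + γR G) ≡ 6 * n → InClassG G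
  equality (inj₁ lt) eq = contradiction
    (<-≤-trans (≤-<-trans γ≤weight lt) (≤-reflexive 6|V|≡6n)) (≤⇒≯ (≤-reflexive (≡-sym eq)))
  equality (inj₂ (_ , paths)) eq with paths⇒tiling G ∈-allFin length-allFin paths
  ... | k , T = classify G conn (≤-reflexive (≡-sym eq)) T (nonempty (Tiling.size T))
  lower : InClassG G → 6 * n ≤ 4 * (γr2 G + γR G)
  lower (inj₁ t₂) = class-T₂-bound G t₂
  lower (inj₂ tₖ) = class-Tₖ-bound G tₖ
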